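{- Let $G=(V,E,w)$ be a simple, connected, undirected graph with positive edge lengths $w$, and let $s,t\in V$, with $n=|V|$, $m=|E|$. If $d_s(v)=d(s,v)$ and $d_t(v)=d(v,t)$ are given for all $v\in V$, then the optimal outward path problem for $(G,s,t)$ can be solved in $O(m+n)$ time.
   Context: A path is always a simple path (no repeated vertex); an $st$-path is a simple path from $s$ to $t$. The length of a path is the sum of the lengths of its edges, and $d(x,y)$ denotes the shortest path length between $x$ and $y$ in $G$. Let $D$ be the subgraph of $G$ formed by the union of all shortest $st$-paths. The optimal outward path problem asks for an $st$-path of minimum length among all $st$-paths containing at least one edge of $E\setminus E(D)$ (or to report that none exists). -}

module Defs where

open import Level using (Level; _⊔_) renaming (suc to lsuc)
open import Algebra.Structures using (IsAbelianGroup)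
open import Data.Bool using (Bool; true; false; if_then_else_; _∧_; not)
open import Data.Fin using (Fin; zero; suc; toℕ)
import Data.List as List
open import Data.List using (List; []; _∷_)
open import Data.List.Membership.Propositional using (_∈_)
open import Data.List.Relation.Unary.Unique.Propositional using (Unique)
open import Data.Nat as ℕ using (ℕ; zero; suc)
import Data.Nat.DivMod as ℕ
open import Data.Product using (Σ-syntax; ∃-syntax; _×_; _,_)
open import Data.Sum using (_⊎_)
open import Data.Unit using (⊤)
import Data.Vec as Vec
open import Data.Vec using ([]; _∷_)
open import Relation.Binary.Core using (Rel)
import Relation.Binary.Construct.NonStrictToStrict as ToStrict
open import Relation.Binary.PropositionalEquality using (_≡_; _≢_)
open import Relation.Binary.Structures using (IsDecTotalOrder)
open import Relation.Nullary using (¬_; does)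

------------------------------------------------------------------------
-- Edge lengths

-- The additive ordered group of the reals, abstractly.  Decidability of
-- the order is the unit-cost exact comparison of the real RAM.
record OrderedAbelianGroup (a ℓ₁ ℓ₂ : Level) : Set (lsuc (a ⊔ ℓ₁ ⊔ ℓ₂)) where
  infix  8 -_
  infixl 6 _+_
  infix  4 _≈_ _≤_
  field
    Carrier         : Set a
    _≈_             : Rel Carrier ℓ₁
    _≤_             : Rel Carrier ℓ₂
    _+_             : Carrier → Carrier → Carrier
    0#              : Carrier
    -_              : Carrier → Carrier
    isAbelianGroup  : IsAbelianGroup _≈_ _+_ 0# -_
    isDecTotalOrder : IsDecTotalOrder _≈_ _≤_
    +-monoʳ-≤       : ∀ x {y z} → y ≤ z → (x + y) ≤ (x + z)

  open IsAbelianGroup isAbelianGroup public using (_-_)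
  open IsDecTotalOrder isDecTotalOrder public using (_≤?_)
  open ToStrict _≈_ _≤_ public using (_<_)

------------------------------------------------------------------------
-- Graphs and paths

-- Vertex set Fin n, edge set Fin m.
record Graph {a ℓ₁ ℓ₂} (R : OrderedAbelianGroup a ℓ₁ ℓ₂) (n m : ℕ)
             : Set (a ⊔ ℓ₁ ⊔ ℓ₂) where
  open OrderedAbelianGroup R
  field
    end₁ end₂ : Fin m → Fin n
    w         : Fin m → Carrier

  Joins : Fin m → Fin n → Fin n → Set
  Joins e u v = (end₁ e ≡ u × end₂ e ≡ v) ⊎ (end₁ e ≡ v × end₂ e ≡ u)

  field
    loopless : ∀ e → end₁ e ≢ end₂ e
    simple   : ∀ {e f u v} → Joins e u v → Joins f u v → e ≡ f
    positive : ∀ e → 0# < w e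

module _ {a ℓ₁ ℓ₂} {R : OrderedAbelianGroup a ℓ₁ ℓ₂} {n m : ℕ}
         (G : Graph R n m) where
  open OrderedAbelianGroup R
  open Graph G

  data Walk : Fin n → Fin n → Set where
    stop : ∀ {u} → Walk u u
    step : ∀ {u v x} (e : Fin m) → Joins e u v → Walk v x → Walk u x

  walkVertices : ∀ {u v} → Walk u v → List (Fin n)
  walkVertices {u} stop         = u ∷ []
  walkVertices {u} (step _ _ p) = u ∷ walkVertices p

  walkEdges : ∀ {u v} → Walk u v → List (Fin m)
  walkEdges stop         = []
  walkEdges (step e _ p) = e ∷ walkEdges p

  Path : Fin n → Fin n → Set
  Path u v = Σ[ p ∈ Walk u v ] Unique (walkVertices p)

  vertices : ∀ {u v} → Path u v → List (Fin n)
  vertices (p , _) = walkVertices p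

  edges : ∀ {u v} → Path u v → List (Fin m)
  edges (p , _) = walkEdges p

  length : ∀ {u v} → Path u v → Carrier
  length p = List.foldr _+_ 0# (List.map w (edges p))

  Connected : Set
  Connected = ∀ u v → Path u v

  Shortest : ∀ {u v} → Path u v → Set ℓ₂
  Shortest {u} {v} p = (q : Path u v) → length p ≤ length q

  IsDistance : Fin n → Fin n → Carrier → Set (ℓ₁ ⊔ ℓ₂)
  IsDistance u v d = Σ[ p ∈ Path u v ] Shortest p × length p ≈ d

  -- Membership in E(D), D being the union of all shortest st-paths.
  InD : Fin n → Fin n → Fin m → Set ℓ₂
  InD s t e = Σ[ p ∈ Path s t ] Shortest p × e ∈ edges p

  Outward : ∀ {s t} → Path s t → Set ℓ₂
  Outward {s} {t} p = ∃[ e ] e ∈ edges p × ¬ InD s t e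

  OptimalOutward : ∀ {s t} → Path s t → Set ℓ₂
  OptimalOutward {s} {t} p =
    Outward p × ((q : Path s t) → Outward q → length p ≤ length q)

------------------------------------------------------------------------
-- A word RAM with a separate memory for edge lengths
--
-- Both memories consist of arrays; a program, being finite, names only
-- finitely many of them.  A scalar variable is cell 0 of an array.
-- Numbers can only be copied, added, subtracted and compared.

ArrayName : Set
ArrayName = ℕ

infix  9 _[_] _[_]ⁿ
infixl 7 _⊗_ _⊘_
infixl 6 _⊕_ _⊖_ _⊕ⁿ_ _⊖ⁿ_
infix  5 _≤ʷ_ _≤ⁿ_
infix  4 _[_]≔_ _[_]≔ⁿ_
infixr 3 _⨟_

data WordExp : Set where
  lit             : ℕ → WordExp
  _[_]            : ArrayName → WordExp → WordExp
  _⊕_ _⊖_ _⊗_ _⊘_ : WordExp → WordExp → WordExp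

data NumExp : Set where
  0ⁿ        : NumExp
  _[_]ⁿ     : ArrayName → WordExp → NumExp
  _⊕ⁿ_ _⊖ⁿ_ : NumExp → NumExp → NumExp

data Test : Set where
  _≤ʷ_ : WordExp → WordExp → Test
  _≤ⁿ_ : NumExp → NumExp → Test
  notᵗ : Test → Test
  _∧ᵗ_ : Test → Test → Test

data Program : Set where
  skip    : Program
  _[_]≔_  : ArrayName → WordExp → WordExp → Program
  _[_]≔ⁿ_ : ArrayName → WordExp → NumExp → Program
  _⨟_     : Program → Program → Program
  cond    : Test → Program → Program → Program
  while   : Test → Program → Program

Arrays : ∀ {a} → Set a → Set a
Arrays A = ArrayName → ℕ → A

write : ∀ {a} {A : Set a} → ArrayName → ℕ → A → Arrays A → Arrays A
write x i v M y j =
  if does (x ℕ.≟ y) ∧ does (i ℕ.≟ j) then v else M y j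

-- Division by zero yields zero.
quot : ℕ → ℕ → ℕ
quot x zero    = 0
quot x (suc y) = x ℕ./ suc y

module _ {a ℓ₁ ℓ₂} (R : OrderedAbelianGroup a ℓ₁ ℓ₂) where
  open OrderedAbelianGroup R

  record State : Set a where
    constructor state
    field
      words : Arrays ℕ
      nums  : Arrays Carrier

module _ {a ℓ₁ ℓ₂} {R : OrderedAbelianGroup a ℓ₁ ℓ₂} where
  open OrderedAbelianGroup R
  open State

  evalʷ : State R → WordExp → ℕ
  evalʷ σ (lit k)   = k
  evalʷ σ (x [ i ]) = words σ x (evalʷ σ i)
  evalʷ σ (i ⊕ j)   = evalʷ σ i ℕ.+ evalʷ σ j
  evalʷ σ (i ⊖ j)   = evalʷ σ i ℕ.∸ evalʷ σ j
  evalʷ σ (i ⊗ j)   = evalʷ σ i ℕ.* evalʷ σ j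
  evalʷ σ (i ⊘ j)   = quot (evalʷ σ i) (evalʷ σ j)

  evalⁿ : State R → NumExp → Carrier
  evalⁿ σ 0ⁿ         = 0#
  evalⁿ σ (x [ i ]ⁿ) = nums σ x (evalʷ σ i)
  evalⁿ σ (p ⊕ⁿ q)   = evalⁿ σ p + evalⁿ σ q
  evalⁿ σ (p ⊖ⁿ q)   = evalⁿ σ p - evalⁿ σ q

  evalᵗ : State R → Test → Bool
  evalᵗ σ (i ≤ʷ j) = does (evalʷ σ i ℕ.≤? evalʷ σ j)
  evalᵗ σ (p ≤ⁿ q) = does (evalⁿ σ p ≤? evalⁿ σ q)
  evalᵗ σ (notᵗ b) = not (evalᵗ σ b)
  evalᵗ σ (b ∧ᵗ c) = evalᵗ σ b ∧ evalᵗ σ c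

  -- Absence of overflow for words bounded by L.  Reads need no check: the
  -- input words are at most m + n, and every word written was checked.
  Fitsʷ : ℕ → State R → WordExp → Set
  Fitsʷ L σ (lit k)   = k ℕ.≤ L
  Fitsʷ L σ (x [ i ]) = Fitsʷ L σ i
  Fitsʷ L σ (i ⊕ j)   = Fitsʷ L σ i × Fitsʷ L σ j × evalʷ σ (i ⊕ j) ℕ.≤ L
  Fitsʷ L σ (i ⊖ j)   = Fitsʷ L σ i × Fitsʷ L σ j
  Fitsʷ L σ (i ⊗ j)   = Fitsʷ L σ i × Fitsʷ L σ j × evalʷ σ (i ⊗ j) ℕ.≤ L
  Fitsʷ L σ (i ⊘ j)   = Fitsʷ L σ i × Fitsʷ L σ j

  Fitsⁿ : ℕ → State R → NumExp → Set
  Fitsⁿ L σ 0ⁿ         = ⊤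
  Fitsⁿ L σ (x [ i ]ⁿ) = Fitsʷ L σ i
  Fitsⁿ L σ (p ⊕ⁿ q)   = Fitsⁿ L σ p × Fitsⁿ L σ q
  Fitsⁿ L σ (p ⊖ⁿ q)   = Fitsⁿ L σ p × Fitsⁿ L σ q

  Fitsᵗ : ℕ → State R → Test → Set
  Fitsᵗ L σ (i ≤ʷ j) = Fitsʷ L σ i × Fitsʷ L σ j
  Fitsᵗ L σ (p ≤ⁿ q) = Fitsⁿ L σ p × Fitsⁿ L σ q
  Fitsᵗ L σ (notᵗ b) = Fitsᵗ L σ b
  Fitsᵗ L σ (b ∧ᵗ c) = Fitsᵗ L σ b × Fitsᵗ L σ c

  -- L ⊢ ⟨ P , σ ⟩⇓⟨ σ′ , τ ⟩: on words bounded by L, P started in σ halts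
  -- in σ′ after τ steps.  Each assignment, test and skip costs one step;
  -- the expressions in it have a size fixed by the program.
  infix 4 _⊢⟨_,_⟩⇓⟨_,_⟩

  data _⊢⟨_,_⟩⇓⟨_,_⟩ (L : ℕ) : Program → State R → State R → ℕ → Set a where
    ⇓skip : ∀ {σ} → L ⊢⟨ skip , σ ⟩⇓⟨ σ , 1 ⟩

    ⇓word : ∀ {σ x i j} → Fitsʷ L σ i → Fitsʷ L σ j →
            L ⊢⟨ x [ i ]≔ j , σ ⟩⇓⟨
              state (write x (evalʷ σ i) (evalʷ σ j) (words σ)) (nums σ) , 1 ⟩

    ⇓num : ∀ {σ x i p} → Fitsʷ L σ i → Fitsⁿ L σ p →
           L ⊢⟨ x [ i ]≔ⁿ p , σ ⟩⇓⟨
             state (words σ) (write x (evalʷ σ i) (evalⁿ σ p) (nums σ)) , 1 ⟩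

    ⇓seq : ∀ {P Q σ σ′ σ″ τ τ′} →
           L ⊢⟨ P , σ ⟩⇓⟨ σ′ , τ ⟩ → L ⊢⟨ Q , σ′ ⟩⇓⟨ σ″ , τ′ ⟩ →
           L ⊢⟨ P ⨟ Q , σ ⟩⇓⟨ σ″ , τ ℕ.+ τ′ ⟩

    ⇓then : ∀ {b P Q σ σ′ τ} → Fitsᵗ L σ b → evalᵗ σ b ≡ true →
            L ⊢⟨ P , σ ⟩⇓⟨ σ′ , τ ⟩ →
            L ⊢⟨ cond b P Q , σ ⟩⇓⟨ σ′ , suc τ ⟩

    ⇓else : ∀ {b P Q σ σ′ τ} → Fitsᵗ L σ b → evalᵗ σ b ≡ false →
            L ⊢⟨ Q , σ ⟩⇓⟨ σ′ , τ ⟩ →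
            L ⊢⟨ cond b P Q , σ ⟩⇓⟨ σ′ , suc τ ⟩

    ⇓exit : ∀ {b P σ} → Fitsᵗ L σ b → evalᵗ σ b ≡ false →
            L ⊢⟨ while b P , σ ⟩⇓⟨ σ , 1 ⟩

    ⇓loop : ∀ {b P σ σ′ σ″ τ τ′} → Fitsᵗ L σ b → evalᵗ σ b ≡ true →
            L ⊢⟨ P , σ ⟩⇓⟨ σ′ , τ ⟩ → L ⊢⟨ while b P , σ′ ⟩⇓⟨ σ″ , τ′ ⟩ →
            L ⊢⟨ while b P , σ ⟩⇓⟨ σ″ , suc (τ ℕ.+ τ′) ⟩

------------------------------------------------------------------------
-- Input and output of the optimal outward path problem

pad : ∀ {a} {A : Set a} {k} → A → (Fin k → A) → ℕ → A
pad {k = zero}  d f i       = d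
pad {k = suc k} d f zero    = f zero
pad {k = suc k} d f (suc i) = pad d (λ j → f (suc j)) i

module _ {a ℓ₁ ℓ₂} {R : OrderedAbelianGroup a ℓ₁ ℓ₂} {n m : ℕ}
         (G : Graph R n m) (s t : Fin n) where
  open OrderedAbelianGroup R
  open Graph G

  -- The graph is given as an unsorted list of edges, from which adjacency
  -- lists can be built in O(m + n) time.  All other cells are zero.
  input : (dₛ dₜ : Fin n → Carrier) → State R
  input dₛ dₜ = state inputWords inputNums
    where
    inputWords : Arrays ℕ
    inputWords 0 = pad 0 (Vec.lookup (n ∷ m ∷ toℕ s ∷ toℕ t ∷ []))
    inputWords 1 = pad 0 (λ e → toℕ (end₁ e))
    inputWords 2 = pad 0 (λ e → toℕ (end₂ e))
    inputWords _ = λ _ → 0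

    inputNums : Arrays Carrier
    inputNums 0 = pad 0# w
    inputNums 1 = pad 0# dₛ
    inputNums 2 = pad 0# dₜ
    inputNums _ = λ _ → 0#

  -- Word array 3 holds, in cell 0, the number of vertices of the path
  -- found (0 if there is none); word array 4 lists these vertices.
  OutputsPath : State R → Path G s t → Set
  OutputsPath σ p =
    State.words σ 3 0 ≡ List.length (vertices G p) ×
    (∀ i → State.words σ 4 (toℕ i) ≡ toℕ (List.lookup (vertices G p) i))

  SolvesOptimalOutwardPath : State R → Set ℓ₂
  SolvesOptimalOutwardPath σ =
    (Σ[ p ∈ Path G s t ] OptimalOutward G p × OutputsPath σ p) ⊎
    ((¬ (Σ[ p ∈ Path G s t ] Outward G p)) × State.words σ 3 0 ≡ 0)

{-# OPTIONS --safe #-}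
module Submission where

-- Let D be the union of the shortest st-paths and call its vertices core.  In
-- shortest path trees of s and t, label each vertex v by the first core vertex
-- on its way to s, resp. t.  An edge uv outside D is a candidate if the s-label
-- of u differs from the t-label of v.  An outward path leaves D at some core
-- vertex x and returns at another one; following it from x until the labels
-- stop being equal to x yields a candidate with dₛ u + w + dₜ v at most its
-- length.  Conversely, for a candidate of minimum value the tree paths s ⋯ u and
-- v ⋯ t are disjoint: a common vertex outside the core would give a cheaper
-- candidate, and a common core vertex makes the reversed detour cheaper.  The
-- labels are found in linear time by climbing the trees to the next labelled
-- vertex and then labelling the vertices climbed.

open import Level using (_⊔_)
open import Algebra.Bundles using (CommutativeMonoid)
open import Algebra.Structures using (IsAbelianGroup)
import Algebra.Solver.CommutativeMonoid as CMSolver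
open import Data.Bool using (true; false)
open import Data.Empty using (⊥; ⊥-elim)
open import Data.Fin as Fin using (Fin; toℕ; fromℕ<)
import Data.Fin.Induction as Fin
import Data.Fin.Properties as Fin
import Data.List as List
open import Data.List using (List; []; _∷_; reverse; _ʳ++_; _++_)
open import Data.List.Membership.Propositional using (_∈_)
open import Data.List.Membership.Propositional.Properties using (∈-lookup)
import Data.List.Properties as List
open import Data.List.Relation.Binary.Disjoint.Propositional using (Disjoint)
open import Data.List.Relation.Unary.All as All using (All; []; _∷_)
open import Data.List.Relation.Unary.All.Properties using (¬Any⇒All¬; All¬⇒¬Any)
open import Data.List.Relation.Unary.AllPairs using ([]; _∷_)
open import Data.List.Relation.Unary.Any as Any using (here; there)
open import Data.List.Relation.Unary.Unique.Propositional using (Unique)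
open import Data.Nat as ℕ using (ℕ; zero; suc; _+_; _*_; _≤_; _<_; z≤n; s≤s)
import Data.Nat.Properties as ℕ
open import Data.Nat.Tactic.RingSolver using (solve-∀)
open import Data.Product as Product using (Σ-syntax; ∃-syntax; _×_; _,_; proj₁; proj₂)
open import Data.Sum using (_⊎_; inj₁; inj₂; swap; [_,_]′)
open import Data.Unit using (⊤)
open import Function using (_∘_; id; case_of_)
open import Induction.WellFounded using (Acc; acc; WellFounded)
open import Relation.Binary.PropositionalEquality
  using (_≡_; _≢_; refl; sym; trans; cong; cong₂; subst; isEquivalence; resp₂)
open import Relation.Binary.Structures using (IsDecTotalOrder; IsStrictPartialOrder)
open import Relation.Nullary using (¬_; Dec; yes; no; does; contradiction)
open import Relation.Nullary.Decidable using (dec-true; dec-false)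
open import Relation.Unary using (Pred; Decidable)
open import Defs

-- Walks and distances

-- The value `through u e v` of a candidate bounds the length of a walk whose two branches may well
-- share vertices. Comparing two labels is a constant-time substitute for testing disjointness. It
-- is conclusive at a candidate of minimum value, and this suffices because every outward path
-- dominates some candidate. The gain of the reversed detour is explicit: on the core `dₛ + dₜ` is
-- constant, so meeting the core vertices `x` and `y` in the opposite order changes the length by
-- twice `dₛ y - dₛ x`. Lengths live in an abstract ordered group, which offers no numerical
-- recursion and no halving. Recursion towards a root therefore rests on the well-foundedness of a
-- strict order on finitely many vertices, and each estimate is a sum of hypotheses whose
-- cancellation is an identity of commutative monoids. Tight parents need not be unique. The
-- combinatorial part is parametrised by arbitrary shortest path trees and is applied to those that
-- the program has left in memory.

module _ {a ℓ₁ ℓ₂} (R : OrderedAbelianGroup a ℓ₁ ℓ₂) where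
  open OrderedAbelianGroup R renaming (_+_ to _+ᶜ_; _≤_ to _≤ᶜ_)
  private
    module A = IsAbelianGroup isAbelianGroup
    module O = IsDecTotalOrder isDecTotalOrder

  +-commutativeMonoid : CommutativeMonoid a ℓ₁
  +-commutativeMonoid = record { isCommutativeMonoid = A.isCommutativeMonoid }

  +-mono-≤ : ∀ {x y u v} → x ≤ᶜ y → u ≤ᶜ v → x +ᶜ u ≤ᶜ y +ᶜ v
  +-mono-≤ {x} {y} {u} {v} x≤y u≤v = O.trans (+-monoʳ-≤ x u≤v)
    (O.trans (O.reflexive (A.comm x v)) (O.trans (+-monoʳ-≤ v x≤y) (O.reflexive (A.comm v y))))

  +-cancelʳ-≤ : ∀ x {y z} → y +ᶜ x ≤ᶜ z +ᶜ x → y ≤ᶜ z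
  +-cancelʳ-≤ x {y} {z} le = O.trans (O.reflexive (A.sym (lemma y)))
      (O.trans (+-mono-≤ le (O.refl {x = - x})) (O.reflexive (lemma z)))
    where
    lemma : ∀ u → (u +ᶜ x) +ᶜ - x ≈ u
    lemma u = A.trans (A.assoc u x (- x))
      (A.trans (A.∙-cong A.refl (A.inverseʳ x)) (A.identityʳ u))

  abstract
    -- The form of a Farkas certificate: the conclusion x ≤ y follows from the
    -- sum l ≤ r of the hypotheses when the two add up to an identity.
    farkas : ∀ {l r x y} → l ≤ᶜ r → x +ᶜ r ≈ y +ᶜ l → x ≤ᶜ y
    farkas {l} {r} {x} {y} l≤r eq =
      +-cancelʳ-≤ r (O.trans (O.reflexive eq) (+-monoʳ-≤ y l≤r))

module _ {A : Set} where

  Unique-ʳ++ : ∀ {xs ys : List A} → Unique xs → Unique ys → Disjoint xs ys → Unique (xs ʳ++ ys)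
  Unique-ʳ++ {[]} ux uy dis = uy
  Unique-ʳ++ {x ∷ xs} (x∉ ∷ ux) uy dis = Unique-ʳ++ {xs} ux
    (¬Any⇒All¬ _ (λ x∈ys → dis (here refl , x∈ys)) ∷ uy)
    λ { (z∈xs , here refl) → All¬⇒¬Any x∉ z∈xs
      ; (z∈xs , there z∈ys) → dis (there z∈xs , z∈ys) }

-- Walks, their lengths and their reversal

module _ {a ℓ₁ ℓ₂} {R : OrderedAbelianGroup a ℓ₁ ℓ₂} {n m : ℕ} (G : Graph R n m) where
  open OrderedAbelianGroup R renaming (_+_ to _+ᶜ_; _≤_ to _≤ᶜ_)
  open Graph G
  private
    module O = IsDecTotalOrder isDecTotalOrder
    module ≈ = IsAbelianGroup isAbelianGroup
  open CMSolver (+-commutativeMonoid R) using (solve; _⊜_) renaming (_⊕_ to _:+_; id to :0)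

  walkLength : ∀ {u v} → Walk G u v → Carrier
  walkLength p = List.foldr _+ᶜ_ 0# (List.map w (walkEdges G p))

  Joins-sym : ∀ {e u v} → Joins e u v → Joins e v u
  Joins-sym = swap

  -- Tree branches run from a vertex to the root, so in an st-walk the branch of `s` has to be
  -- turned round in front of the remaining walk. The accumulator mirrors `_ʳ++_` on vertex lists.
  _reverseOnto_ : ∀ {u v x} → Walk G u v → Walk G u x → Walk G v x
  stop       reverseOnto q = q
  step e j p reverseOnto q = p reverseOnto step e (Joins-sym {e} j) q

  -- Both walks of a `_reverseOnto_` contain the junction vertex; dropping the head of the second
  -- one avoids listing it twice.
  laterVertices : ∀ {u v} → Walk G u v → List (Fin n)
  laterVertices stop         = []
  laterVertices (step _ _ p) = walkVertices G p

  walkVertices-∷ : ∀ {u v} (p : Walk G u v) → walkVertices G p ≡ u ∷ laterVertices p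
  walkVertices-∷ stop         = refl
  walkVertices-∷ (step _ _ p) = refl

  walkVertices-reverseOnto : ∀ {u v x} (p : Walk G u v) (q : Walk G u x) →
    walkVertices G (p reverseOnto q) ≡ walkVertices G p ʳ++ laterVertices q
  walkVertices-reverseOnto stop q = walkVertices-∷ q
  walkVertices-reverseOnto (step e j p) q =
    trans (walkVertices-reverseOnto p (step e (Joins-sym {e} j) q))
          (cong (walkVertices G p ʳ++_) (walkVertices-∷ q))

  walkLength-reverseOnto : ∀ {u v x} (p : Walk G u v) (q : Walk G u x) →
    walkLength (p reverseOnto q) ≈ walkLength p +ᶜ walkLength q
  walkLength-reverseOnto stop q = ≈.sym (≈.identityˡ _)
  walkLength-reverseOnto (step e j p) q =
    ≈.trans (walkLength-reverseOnto p (step e (Joins-sym {e} j) q))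
      (solve 3 (λ p w q → p :+ (w :+ q) ⊜ (w :+ p) :+ q) ≈.refl (walkLength p) (w e) (walkLength q))

  ∈-reverseOnto : ∀ {u v x f} (p : Walk G u v) {q : Walk G u x} →
    f ∈ walkEdges G q → f ∈ walkEdges G (p reverseOnto q)
  ∈-reverseOnto stop         f∈q = f∈q
  ∈-reverseOnto (step e j p) f∈q = ∈-reverseOnto p (there f∈q)

  reversePath : ∀ {u v} → Path G u v → Path G v u
  reversePath (p , up) = p reverseOnto stop ,
    subst Unique (sym (walkVertices-reverseOnto p stop)) (Unique-ʳ++ up [] λ ())

  length-reversePath : ∀ {u v} (p : Path G u v) → length G (reversePath p) ≈ length G p
  length-reversePath (p , _) = ≈.trans (walkLength-reverseOnto p stop) (≈.identityʳ _)

  IsDistance-sym : ∀ {u v d} → IsDistance G u v d → IsDistance G v u d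
  IsDistance-sym (p , shortest , len) = reversePath p ,
    (λ q → O.trans (O.reflexive (length-reversePath p))
       (O.trans (shortest (reversePath q)) (O.reflexive (length-reversePath q)))) ,
    ≈.trans (length-reversePath p) len

  -- Distances as potentials

  0≤w : ∀ e → 0# ≤ᶜ w e
  0≤w e = proj₁ (positive e)

  w≰0 : ∀ e → ¬ (w e ≤ᶜ 0#)
  w≰0 e w≤0 = proj₂ (positive e) (O.antisym (0≤w e) w≤0)

  0≤walkLength : ∀ {u v} (p : Walk G u v) → 0# ≤ᶜ walkLength p
  0≤walkLength stop         = O.refl
  0≤walkLength (step e _ p) = farkas R (+-mono-≤ R (0≤w e) (0≤walkLength p))
    (solve 2 (λ w p → :0 :+ (w :+ p) ⊜ (w :+ p) :+ (:0 :+ :0)) ≈.refl (w e) (walkLength p))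

  -- The distance to `r` expressed by inequalities alone: `lipschitz` and `d[r]≤0` bound it from
  -- above by walk lengths, while `tight` and `0≤d` provide a walk that attains it. One-sided
  -- statements fit arguments that only add inequalities.
  record IsPotential (r : Fin n) (d : Fin n → Carrier) : Set (a ⊔ ℓ₂) where
    field
      d[r]≤0    : d r ≤ᶜ 0#
      0≤d       : ∀ v → 0# ≤ᶜ d v
      lipschitz : ∀ {e u v} → Joins e u v → d u ≤ᶜ w e +ᶜ d v
      tight     : ∀ {v} → v ≢ r → ∃[ e ] ∃[ u ] Joins e v u × w e +ᶜ d u ≤ᶜ d v

  suffix : ∀ {u v z} (p : Walk G u v) → Unique (walkVertices G p) → z ∈ walkVertices G p →
    Σ[ q ∈ Path G z v ] length G q ≤ᶜ walkLength p
  suffix stop up (here refl) = (stop , up) , O.refl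
  suffix (step e j p) up (here refl) = (step e j p , up) , O.refl
  suffix (step e j p) (_ ∷ up) (there z∈p) with suffix p up z∈p
  ... | q , q≤p = q , farkas R (+-mono-≤ R q≤p (0≤w e))
    (solve 3 (λ q w p → q :+ (p :+ w) ⊜ (w :+ p) :+ (q :+ :0)) ≈.refl (length G q) (w e) (walkLength p))

  -- Prepending the edge may revisit `u`. In that case the part of the path from `u` on is itself a
  -- path, and it is no longer because edge lengths are positive.
  extend : ∀ {e u v x} → Joins e u v → (p : Path G v x) →
    Σ[ q ∈ Path G u x ] length G q ≤ᶜ w e +ᶜ length G p
  extend {e} {u} j (p , up) with Any.any? (u Fin.≟_) (walkVertices G p)
  ... | no u∉p = (step e j p , ¬Any⇒All¬ _ u∉p ∷ up) , O.refl
  ... | yes u∈p with suffix p up u∈p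
  ...   | q , q≤p = q , farkas R (+-mono-≤ R q≤p (0≤w e))
    (solve 3 (λ q w p → q :+ (p :+ w) ⊜ (w :+ p) :+ (q :+ :0)) ≈.refl (length G q) (w e) (walkLength p))

  -- The triangle inequality comes from `extend`. A tight edge at `v` is the first edge of a
  -- shortest path, since the tail of that path bounds the distance of the next vertex.
  distance⇒potential : ∀ {r d} → (∀ v → IsDistance G v r (d v)) → IsPotential r d
  distance⇒potential {r} {d} dist = record
    { d[r]≤0 = shorter r (stop , [] ∷ [])
    ; 0≤d = λ v → O.trans (0≤walkLength (proj₁ (proj₁ (dist v)))) (O.reflexive (proj₂ (proj₂ (dist v))))
    ; lipschitz = lip
    ; tight = tight }
    where
    shorter : ∀ v (q : Path G v r) → d v ≤ᶜ length G q
    shorter v q = O.trans (O.reflexive (≈.sym (proj₂ (proj₂ (dist v))))) (proj₁ (proj₂ (dist v)) q)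

    lip : ∀ {e u v} → Joins e u v → d u ≤ᶜ w e +ᶜ d v
    lip {e} {u} {v} j with dist v
    ... | p , _ , len with extend j p
    ...   | q , q≤ = O.trans (shorter u q) (O.trans q≤ (+-monoʳ-≤ (w e) (O.reflexive len)))

    tight : ∀ {v} → v ≢ r → ∃[ e ] ∃[ u ] Joins e v u × w e +ᶜ d u ≤ᶜ d v
    tight {v} v≢r with dist v
    ... | (stop , _) , _ = contradiction refl v≢r
    ... | (step {v = u} e j p , _ ∷ up) , _ , len =
      e , u , j , O.trans (+-monoʳ-≤ (w e) (shorter u (p , up))) (O.reflexive len)

  -- Geodesics of a potential

  module _ {r d} (pot : IsPotential r d) where
    open IsPotential pot

    walk-lipschitz : ∀ {u v} (p : Walk G u v) → d u ≤ᶜ walkLength p +ᶜ d v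
    walk-lipschitz stop = O.reflexive (≈.sym (≈.identityˡ _))
    walk-lipschitz {u} {v} (step {v = x} e j p) =
      farkas R (+-mono-≤ R (lipschitz j) (walk-lipschitz p))
        (solve 5 (λ du w dx p dv → du :+ ((w :+ dx) :+ (p :+ dv)) ⊜ ((w :+ p) :+ dv) :+ (du :+ dx))
          ≈.refl (d u) (w e) (d x) (walkLength p) (d v))

    -- The opposite inequality is `walk-lipschitz`, so the length of a geodesic is exactly the drop
    -- of the potential along it.
    Geodesic : ∀ {u v} → Walk G u v → Set ℓ₂
    Geodesic {u} {v} p = walkLength p +ᶜ d v ≤ᶜ d u

    geodesic-tail : ∀ {e u v x} {j : Joins e u v} (p : Walk G v x) → Geodesic (step e j p) → Geodesic p
    geodesic-tail {e} {u} {v} {x} {j} p geo = farkas R (+-mono-≤ R geo (lipschitz j))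
      (solve 5 (λ du w dv p dx → (p :+ dx) :+ (du :+ (w :+ dv)) ⊜ dv :+ (((w :+ p) :+ dx) :+ du))
        ≈.refl (d u) (w e) (d v) (walkLength p) (d x))

    geodesic-descent : ∀ {e u v x} {j : Joins e u v} (p : Walk G v x) → Geodesic (step e j p) →
        w e +ᶜ d v ≤ᶜ d u
    geodesic-descent {e} {u} {v} {x} p geo = farkas R (+-mono-≤ R geo (walk-lipschitz p))
      (solve 5 (λ du w dv p dx → (w :+ dv) :+ (du :+ (p :+ dx)) ⊜ du :+ (((w :+ p) :+ dx) :+ dv))
        ≈.refl (d u) (w e) (d v) (walkLength p) (d x))

    geodesic-below : ∀ {u v z} (p : Walk G u v) → Geodesic p → z ∈ walkVertices G p → d z ≤ᶜ d u
    geodesic-below stop geo (here refl) = O.refl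
    geodesic-below (step e j p) geo (here refl) = O.refl
    geodesic-below {u} {v} {z} (step {v = x} e j p) geo (there z∈p) =
      farkas R (+-mono-≤ R (geodesic-below p (geodesic-tail {j = j} p geo) z∈p)
                 (+-mono-≤ R (geodesic-descent {j = j} p geo) (0≤w e)))
        (solve 4 (λ dz dx w du → dz :+ (dx :+ (du :+ w)) ⊜ du :+ (dz :+ ((w :+ dx) :+ :0)))
          ≈.refl (d z) (d x) (w e) (d u))

    descent-≰ : ∀ {e u v} → w e +ᶜ d v ≤ᶜ d u → ¬ (d u ≤ᶜ d v)
    descent-≰ {e} {u} {v} desc du≤dv = w≰0 e (farkas R (+-mono-≤ R desc du≤dv)
      (solve 3 (λ w du dv → w :+ (du :+ dv) ⊜ :0 :+ ((w :+ dv) :+ du)) ≈.refl (w e) (d u) (d v)))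

    -- The potential drops strictly along every edge of a geodesic, so no vertex can return.
    geodesic⇒Unique : ∀ {u v} (p : Walk G u v) → Geodesic p → Unique (walkVertices G p)
    geodesic⇒Unique stop geo = [] ∷ []
    geodesic⇒Unique (step e j p) geo =
      ¬Any⇒All¬ _ (λ u∈p → descent-≰ (geodesic-descent {j = j} p geo)
        (geodesic-below p (geodesic-tail {j = j} p geo) u∈p))

      ∷ geodesic⇒Unique p (geodesic-tail {j = j} p geo)

-- Shortest path trees and candidates

module _ {a ℓ₁ ℓ₂} {R : OrderedAbelianGroup a ℓ₁ ℓ₂} {n m : ℕ} (G : Graph R n m) where
  open OrderedAbelianGroup R renaming (_+_ to _+ᶜ_; _≤_ to _≤ᶜ_)
  open Graph G
  private
    module O = IsDecTotalOrder isDecTotalOrder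
    module ≈ = IsAbelianGroup isAbelianGroup
  open CMSolver (+-commutativeMonoid R) using (solve; _⊜_) renaming (_⊕_ to _:+_; id to :0)

  record ShortestPathTree (r : Fin n) (d : Fin n → Carrier) : Set (a ⊔ ℓ₂) where
    field
      parent : Fin n → Fin n
      tight  : ∀ {v} → v ≢ r → ∃[ e ] Joins e v (parent v) × w e +ᶜ d (parent v) ≤ᶜ d v

  -- Branches of a shortest path tree

  module Tree {r d} (pot : IsPotential G r d) (tree : ShortestPathTree r d) where
    open IsPotential pot hiding (tight)
    open ShortestPathTree tree

    -- Evidence that repeated parent steps reach the root. Depth, walks and labels are defined by
    -- recursion on it, since the lengths themselves support no recursion.
    data Branch : Fin n → Set where
      root : Branch r
      up   : ∀ {v} → v ≢ r → Branch (parent v) → Branch v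

    abstract
      -- Having strictly smaller distance is a strict order on a finite set and hence well-founded;
      -- positivity of the edge lengths makes each parent step descend in it.
      branch : ∀ v → Branch v
      branch v = go v (wellFounded v)
        where
        _⊏_ : Fin n → Fin n → Set ℓ₂
        u ⊏ v = ¬ (d v ≤ᶜ d u)

        ⊏-isStrictPartialOrder : IsStrictPartialOrder _≡_ _⊏_
        ⊏-isStrictPartialOrder = record
          { isEquivalence = isEquivalence
          ; irrefl        = λ { refl u⊏u → u⊏u O.refl }
          ; trans         = λ {u} {v} {x} u⊏v v⊏x x≤u →
              [ v⊏x , (λ v≤x → u⊏v (O.trans v≤x x≤u)) ]′ (O.total (d x) (d v))
          ; <-resp-≈      = resp₂ _⊏_ }

        wellFounded : WellFounded _⊏_
        wellFounded = Fin.spo-wellFounded ⊏-isStrictPartialOrder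

        go : ∀ v → Acc _⊏_ v → Branch v
        go v (acc rec) with v Fin.≟ r
        ... | yes refl = root
        ... | no v≢r   = up v≢r (go (parent v) (rec (descent-≰ G pot (proj₂ (proj₂ (tight v≢r))))))

    -- `branch` does not unfold, so an equation between a value at `v` and the value at its parent
    -- is obtained by identifying `branch v` with one step followed by the branch of the parent.
    Branch-unique : ∀ {v} (b c : Branch v) → b ≡ c
    Branch-unique root       root       = refl
    Branch-unique root       (up v≢r _) = contradiction refl v≢r
    Branch-unique (up v≢r _) root       = contradiction refl v≢r
    Branch-unique (up _ b)   (up _ c)   = cong (up _) (Branch-unique b c)

    depth : ∀ {v} → Branch v → ℕ
    depth root     = 0
    depth (up _ b) = suc (depth b)

    depth-parent : ∀ {v} → v ≢ r → depth (branch v) ≡ suc (depth (branch (parent v)))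
    depth-parent {v} v≢r = cong depth (Branch-unique (branch v) (up v≢r (branch (parent v))))

    branchWalk : ∀ {v} → Branch v → Walk G v r
    branchWalk root       = stop
    branchWalk (up v≢r b) = step (proj₁ (tight v≢r)) (proj₁ (proj₂ (tight v≢r))) (branchWalk b)

    branchWalk-length : ∀ {v} (b : Branch v) → walkLength G (branchWalk b) ≤ᶜ d v
    branchWalk-length root = 0≤d r
    branchWalk-length {v} (up v≢r b) with tight v≢r
    ... | e , j , desc = farkas R (+-mono-≤ R (branchWalk-length b) desc)
      (solve 4 (λ w p da dv → (w :+ p) :+ (da :+ dv) ⊜ dv :+ (p :+ (w :+ da))) ≈.refl
        (w e) (walkLength G (branchWalk b)) (d (parent v)) (d v))

    branchWalk-geodesic : ∀ {v} (b : Branch v) → Geodesic G pot (branchWalk b)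
    branchWalk-geodesic {v} b = farkas R (+-mono-≤ R (branchWalk-length b) d[r]≤0)
      (solve 3 (λ p r v → (p :+ r) :+ (v :+ :0) ⊜ v :+ (p :+ r)) ≈.refl
        (walkLength G (branchWalk b)) (d r) (d v))

    -- Labels by the first core vertex on a branch

    module Label {ℓ} {Core : Pred (Fin n) ℓ} (core? : Decidable Core)
                 (core-root : Core r) (core-parent : ∀ {v} → v ≢ r → Core v → Core (parent v)) where

      labelᵇ : ∀ {v} → Branch v → Fin n
      labelᵇ root = r
      labelᵇ (up {v} _ b) with core? v
      ... | yes _ = v
      ... | no _  = labelᵇ b

      private
        labelᵇ-core : ∀ {v} (b : Branch v) → Core v → labelᵇ b ≡ v
        labelᵇ-core root cv = refl
        labelᵇ-core (up {v} _ b) cv with core? v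
        ... | yes _ = refl
        ... | no ¬c = contradiction cv ¬c

        labelᵇ-∈ : ∀ {v} (b : Branch v) → Core (labelᵇ b)
        labelᵇ-∈ root = core-root
        labelᵇ-∈ (up {v} _ b) with core? v
        ... | yes c = c
        ... | no _  = labelᵇ-∈ b

        labelᵇ-up : ∀ {v} (v≢r : v ≢ r) b → ¬ Core v → labelᵇ (up v≢r b) ≡ labelᵇ b
        labelᵇ-up {v} _ b ¬cv with core? v
        ... | yes c = contradiction c ¬cv
        ... | no _  = refl

      abstract
        label : Fin n → Fin n
        label v = labelᵇ (branch v)

        label-core : ∀ {v} → Core v → label v ≡ v
        label-core {v} = labelᵇ-core (branch v)

        core-label : ∀ v → Core (label v)
        core-label v = labelᵇ-∈ (branch v)

        label-parent : ∀ {v} → v ≢ r → ¬ Core v → label v ≡ label (parent v)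
        label-parent {v} v≢r ¬cv =
          trans (cong labelᵇ (Branch-unique (branch v) (up v≢r (branch (parent v)))))
                (labelᵇ-up v≢r _ ¬cv)

        -- The branch segment from `v` to its label has length `d v - d (label v)`, and another
        -- potential changes by at most that much along it. Moving the subtracted terms across
        -- avoids inverses. This is what prices the reversed detour.
        label-detour : ∀ {r′ d′} → IsPotential G r′ d′ → ∀ v → d′ v +ᶜ d (label v) ≤ᶜ d′ (label v) +ᶜ d v
        label-detour {d′ = d′} pot′ v = go (branch v)
          where
          go : ∀ {v} (b : Branch v) → d′ v +ᶜ d (labelᵇ b) ≤ᶜ d′ (labelᵇ b) +ᶜ d v
          go root = O.refl
          go (up {v} v≢r b) with core? v
          ... | yes _ = O.refl
          ... | no _ with tight v≢r
          ...   | e , j , desc =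
              farkas R (+-mono-≤ R (go b) (+-mono-≤ R desc (IsPotential.lipschitz pot′ j)))
            (solve 7 (λ d′v dl d′l dv d′p dp w →
                (d′v :+ dl) :+ ((d′l :+ dp) :+ (dv :+ (w :+ d′p))) ⊜ (d′l :+ dv) :+
                    ((d′p :+ dl) :+ ((w :+ dp) :+ d′v)))
              ≈.refl (d′ v) (d (labelᵇ b)) (d′ (labelᵇ b)) (d v) (d′ (parent v)) (d (parent v)) (w e))

      -- Before the label is reached the branch stays outside the core and the label is constant.
      -- From the label on, closure of the core under parents keeps the branch inside, and the
      -- distance falls strictly below that of the label.
      on-branch : ∀ {v z} (b : Branch v) → z ∈ walkVertices G (branchWalk b) →
        (¬ Core z × label z ≡ label v) ⊎ (Core z × (z ≡ label v ⊎ ¬ (d (label v) ≤ᶜ d z)))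
      on-branch root (here refl) = inj₂ (core-root , inj₁ (sym (label-core core-root)))
      on-branch (up {v} v≢r b) (here refl) with core? v
      ... | yes c = inj₂ (c , inj₁ (sym (label-core c)))
      ... | no ¬c = inj₁ (¬c , refl)
      on-branch {z = z} (up {v} v≢r b) (there z∈b) with core? v
      ... | no ¬c = subst (λ y → (¬ Core z × label z ≡ y) ⊎ (Core z × (z ≡ y ⊎ ¬ (d y ≤ᶜ d z))))
                      (sym (label-parent v≢r ¬c)) (on-branch b z∈b)
      ... | yes c = inj₂ (core-branch b (core-parent v≢r c) z∈b , inj₂ λ lv≤z →
              descent-≰ G pot (proj₂ (proj₂ (tight v≢r)))
                (O.trans (subst (λ y → d y ≤ᶜ d z) (label-core c) lv≤z)
                  (geodesic-below G pot (branchWalk b) (branchWalk-geodesic b) z∈b)))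
        where
        core-branch : ∀ {u z} (b : Branch u) → Core u → z ∈ walkVertices G (branchWalk b) → Core z
        core-branch root         cu (here refl) = cu
        core-branch (up _ _)     cu (here refl) = cu
        core-branch (up u≢r b)   cu (there z∈b) = core-branch b (core-parent u≢r cu) z∈b

  -- The core and a numerical test for edges of D

  module OptimalOutwardPath
    {s t dₛ dₜ} (potₛ : IsPotential G s dₛ) (potₜ : IsPotential G t dₜ)
    (treeₛ : ShortestPathTree s dₛ) (treeₜ : ShortestPathTree t dₜ)
    (dₜ[s]≤dₛ[t] : dₜ s ≤ᶜ dₛ t) (dₛ[t]≤dₜ[s] : dₛ t ≤ᶜ dₜ s)
    where

    private
      module Pₛ = IsPotential potₛ
      module Pₜ = IsPotential potₜ
      module Tₛ = ShortestPathTree treeₛ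
      module Tₜ = ShortestPathTree treeₜ
      module S = Tree potₛ treeₛ
      module T = Tree potₜ treeₜ

    -- The core is V(D), and OffD below is the complement of E(D).
    Core : Fin n → Set ℓ₂
    Core v = dₛ v +ᶜ dₜ v ≤ᶜ dₛ t

    core? : Decidable Core
    core? v = dₛ v +ᶜ dₜ v ≤? dₛ t

    core-s : Core s
    core-s = farkas R (+-mono-≤ R Pₛ.d[r]≤0 dₜ[s]≤dₛ[t])
      (solve 3 (λ a b c → (a :+ b) :+ (:0 :+ c) ⊜ c :+ (a :+ b)) ≈.refl (dₛ s) (dₜ s) (dₛ t))

    core-t : Core t
    core-t = farkas R Pₜ.d[r]≤0
      (solve 2 (λ a b → (a :+ b) :+ :0 ⊜ a :+ b) ≈.refl (dₛ t) (dₜ t))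

    core-parentₛ : ∀ {v} → v ≢ s → Core v → Core (Tₛ.parent v)
    core-parentₛ {v} v≢s cv with Tₛ.tight v≢s
    ... | e , j , desc = farkas R (+-mono-≤ R cv (+-mono-≤ R desc (Pₜ.lipschitz (Joins-sym G {e} j))))
      (solve 6 (λ sp tp sv tv w D →
          (sp :+ tp) :+ (D :+ (sv :+ (w :+ tv))) ⊜ D :+ ((sv :+ tv) :+ ((w :+ sp) :+ tp)))
        ≈.refl (dₛ (Tₛ.parent v)) (dₜ (Tₛ.parent v)) (dₛ v) (dₜ v) (w e) (dₛ t))

    core-parentₜ : ∀ {v} → v ≢ t → Core v → Core (Tₜ.parent v)
    core-parentₜ {v} v≢t cv with Tₜ.tight v≢t
    ... | e , j , desc = farkas R (+-mono-≤ R cv (+-mono-≤ R desc (Pₛ.lipschitz (Joins-sym G {e} j))))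
      (solve 6 (λ sp tp sv tv w D →
          (sp :+ tp) :+ (D :+ (tv :+ (w :+ sv))) ⊜ D :+ ((sv :+ tv) :+ ((w :+ tp) :+ sp)))
        ≈.refl (dₛ (Tₜ.parent v)) (dₜ (Tₜ.parent v)) (dₛ v) (dₜ v) (w e) (dₛ t))

    module Lₛ = S.Label core? core-s core-parentₛ
    module Lₜ = T.Label core? core-t core-parentₜ

    through : Fin n → Fin m → Fin n → Carrier
    through u e v = dₛ u +ᶜ w e +ᶜ dₜ v

    OffD : Fin m → Set ℓ₂
    OffD e = ∀ {u v} → Joins e u v → ¬ (through u e v ≤ᶜ dₛ t)

    onD⇒core : ∀ {u e v} → Joins e u v → through u e v ≤ᶜ dₛ t → Core u × Core v
    onD⇒core {u} {e} {v} j thr =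
      farkas R (+-mono-≤ R thr (Pₜ.lipschitz j))
        (solve 5 (λ su tu w tv D → (su :+ tu) :+ (D :+ (w :+ tv)) ⊜ D :+ (((su :+ w) :+ tv) :+ tu))
          ≈.refl (dₛ u) (dₜ u) (w e) (dₜ v) (dₛ t)) ,
      farkas R (+-mono-≤ R thr (Pₛ.lipschitz (Joins-sym G {e} j)))
        (solve 5 (λ su sv w tv D → (sv :+ tv) :+ (D :+ (w :+ su)) ⊜ D :+ (((su :+ w) :+ tv) :+ sv))
          ≈.refl (dₛ u) (dₛ v) (w e) (dₜ v) (dₛ t))

    noncore⇒offD : ∀ {u e v} → Joins e u v → ¬ Core u → OffD e
    noncore⇒offD (inj₁ (refl , refl)) ¬c (inj₁ (refl , refl)) thr =
        ¬c (proj₁ (onD⇒core (inj₁ (refl , refl)) thr))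
    noncore⇒offD (inj₁ (refl , refl)) ¬c (inj₂ (refl , refl)) thr =
        ¬c (proj₂ (onD⇒core (inj₂ (refl , refl)) thr))
    noncore⇒offD (inj₂ (refl , refl)) ¬c (inj₁ (refl , refl)) thr =
        ¬c (proj₂ (onD⇒core (inj₁ (refl , refl)) thr))
    noncore⇒offD (inj₂ (refl , refl)) ¬c (inj₂ (refl , refl)) thr =
        ¬c (proj₁ (onD⇒core (inj₂ (refl , refl)) thr))

    offD? : ∀ e {u v} → Joins e u v → OffD e ⊎ (through u e v ≤ᶜ dₛ t ⊎ through v e u ≤ᶜ dₛ t)
    offD? e {u} {v} j with through u e v ≤? dₛ t | through v e u ≤? dₛ t
    ... | yes uv | _      = inj₂ (inj₁ uv)
    ... | no _   | yes vu = inj₂ (inj₂ vu)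
    ... | no ¬uv | no ¬vu = inj₁ (off j ¬uv ¬vu)
      where
      off : ∀ {u v} → Joins e u v → ¬ (through u e v ≤ᶜ dₛ t) → ¬ (through v e u ≤ᶜ dₛ t) → OffD e
      off (inj₁ (refl , refl)) ¬uv ¬vu (inj₁ (refl , refl)) = ¬uv
      off (inj₁ (refl , refl)) ¬uv ¬vu (inj₂ (refl , refl)) = ¬vu
      off (inj₂ (refl , refl)) ¬uv ¬vu (inj₁ (refl , refl)) = ¬vu
      off (inj₂ (refl , refl)) ¬uv ¬vu (inj₂ (refl , refl)) = ¬uv

    -- A shortest st-path is no longer than the tree path from `s`, hence at most `dₛ t`. The bound
    -- on `dₛ u` plus the remaining length persists along the path because `dₛ` grows by at most the
    -- length of each edge; at `e` it becomes the bound on `through`.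
    InD⇒¬OffD : ∀ {e} → InD G s t e → ¬ OffD e
    InD⇒¬OffD {e} ((p , up) , shortest , e∈p) off = go p e∈p d≤
      where
      d≤ : dₛ s +ᶜ walkLength G p ≤ᶜ dₛ t
      d≤ = farkas R (+-mono-≤ R (+-mono-≤ R Pₛ.d[r]≤0 (shortest q)) (T-length))
        (solve 5 (λ ss p q D ts → (ss :+ p) :+ ((:0 :+ q) :+ D) ⊜ D :+ ((ss :+ p) :+ q)) ≈.refl
          (dₛ s) (walkLength G p) (walkLength G (proj₁ q)) (dₛ t) (dₜ s))
        where
        q : Path G s t
        q = T.branchWalk (T.branch s) ,
          geodesic⇒Unique G potₜ (T.branchWalk (T.branch s)) (T.branchWalk-geodesic (T.branch s))
        T-length : walkLength G (proj₁ q) ≤ᶜ dₛ t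
        T-length = O.trans (T.branchWalk-length (T.branch s)) dₜ[s]≤dₛ[t]

      go : ∀ {u} (p : Walk G u t) → e ∈ walkEdges G p → dₛ u +ᶜ walkLength G p ≤ᶜ dₛ t → ⊥
      go {u} (step {v = v} f j p) (here refl) le = off j
        (farkas R (+-mono-≤ R le (+-mono-≤ R (walk-lipschitz G potₜ p) Pₜ.d[r]≤0))
          (solve 6 (λ su w tv p D tt →
              ((su :+ w) :+ tv) :+ (D :+ ((p :+ tt) :+ :0)) ⊜ D :+ ((su :+ (w :+ p)) :+ (tv :+ tt)))
            ≈.refl (dₛ u) (w e) (dₜ v) (walkLength G p) (dₛ t) (dₜ t)))
      go {u} (step {v = v} f j p) (there e∈p) le = go p e∈p
        (farkas R (+-mono-≤ R le (Pₛ.lipschitz (Joins-sym G {f} j)))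
          (solve 5 (λ su w sv p D → (sv :+ p) :+ (D :+ (w :+ su)) ⊜ D :+ ((su :+ (w :+ p)) :+ sv))
            ≈.refl (dₛ u) (w f) (dₛ v) (walkLength G p) (dₛ t)))

    treeWalk : ∀ u e v → Joins e u v → Walk G s t
    treeWalk u e v j = _reverseOnto_ G (S.branchWalk (S.branch u)) (step e j (T.branchWalk (T.branch v)))

    treeWalk-length : ∀ u e v (j : Joins e u v) → walkLength G (treeWalk u e v j) ≤ᶜ through u e v
    treeWalk-length u e v j = farkas R
      (+-mono-≤ R (O.reflexive (walkLength-reverseOnto G bₛ (step e j bₜ)))
        (+-mono-≤ R (S.branchWalk-length (S.branch u)) (T.branchWalk-length (T.branch v))))
      (solve 6 (λ W su w tv p q →
          W :+ ((p :+ (w :+ q)) :+ (su :+ tv)) ⊜ ((su :+ w) :+ tv) :+ (W :+ (p :+ q)))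
        ≈.refl (walkLength G (treeWalk u e v j)) (dₛ u) (w e) (dₜ v) (walkLength G bₛ) (walkLength G bₜ))
      where
      bₛ = S.branchWalk (S.branch u)
      bₜ = T.branchWalk (T.branch v)

    treeWalk-∈ : ∀ u e v (j : Joins e u v) → e ∈ walkEdges G (treeWalk u e v j)
    treeWalk-∈ u e v j = ∈-reverseOnto G (S.branchWalk (S.branch u)) (here refl)

    -- The witness is the tree walk through the edge. Its length is at most `dₛ t`, so it is
    -- geodesic for `dₜ`, which makes it both simple and shortest.
    onD⇒InD : ∀ {u e v} → Joins e u v → through u e v ≤ᶜ dₛ t → InD G s t e
    onD⇒InD {u} {e} {v} j thr = (W , geodesic⇒Unique G potₜ W geo) , shortest , treeWalk-∈ u e v j
      where
      W = treeWalk u e v j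

      W≤ : walkLength G W ≤ᶜ dₜ s
      W≤ = O.trans (treeWalk-length u e v j) (O.trans thr dₛ[t]≤dₜ[s])

      geo : Geodesic G potₜ W
      geo = farkas R (+-mono-≤ R W≤ Pₜ.d[r]≤0)
        (solve 3 (λ p r v → (p :+ r) :+ (v :+ :0) ⊜ v :+ (p :+ r)) ≈.refl (walkLength G W) (dₜ t) (dₜ s))

      shortest : ∀ q → walkLength G W ≤ᶜ length G q
      shortest (q , _) = farkas R (+-mono-≤ R W≤ (+-mono-≤ R (walk-lipschitz G potₜ q) Pₜ.d[r]≤0))
        (solve 4 (λ W q ts tt → W :+ (ts :+ ((q :+ tt) :+ :0)) ⊜ q :+ (W :+ (ts :+ tt))) ≈.refl
          (walkLength G W) (walkLength G q) (dₜ s) (dₜ t))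

    ¬InD⇒OffD : ∀ {e} → ¬ InD G s t e → OffD e
    ¬InD⇒OffD ¬in j thr = ¬in (onD⇒InD j thr)

    -- Every outward path dominates a candidate

    record Candidate (u : Fin n) (e : Fin m) (v : Fin n) : Set (a ⊔ ℓ₂) where
      constructor candidate
      field
        joins  : Joins e u v
        offD   : OffD e
        labels : Lₛ.label u ≢ Lₜ.label v

    CandidateBelow : Carrier → Set (a ⊔ ℓ₂)
    CandidateBelow x = ∃[ u ] ∃[ e ] ∃[ v ] Candidate u e v × through u e v ≤ᶜ x

    -- Core vertices carry themselves as both labels, so `z` lies outside the core. The edge to its
    -- parent in the tree of `t` is then off D, preserves the t-label, and being tight does not
    -- raise the value above `dₛ z + dₜ z`.
    vertex-candidate : ∀ z x → Lₛ.label z ≢ Lₜ.label z → dₛ z +ᶜ dₜ z ≤ᶜ x → CandidateBelow x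
    vertex-candidate z x ls≢lt le =
      z , e , Tₜ.parent z , candidate j (noncore⇒offD j ¬core)
        (λ eq → ls≢lt (trans eq (sym (Lₜ.label-parent z≢t ¬core)))) ,
      farkas R (+-mono-≤ R le (proj₂ (proj₂ (Tₜ.tight z≢t))))
        (solve 5 (λ sz w tp tz x → ((sz :+ w) :+ tp) :+ (x :+ tz) ⊜ x :+ ((sz :+ tz) :+ (w :+ tp))) ≈.refl
          (dₛ z) (w e) (dₜ (Tₜ.parent z)) (dₜ z) x)
      where
      ¬core : ¬ Core z
      ¬core c = ls≢lt (trans (Lₛ.label-core c) (sym (Lₜ.label-core c)))

      z≢t : z ≢ t
      z≢t refl = ¬core core-t

      e = proj₁ (Tₜ.tight z≢t)
      j = proj₁ (proj₂ (Tₜ.tight z≢t))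

    private
      abstract
        edge-bound : ∀ u e v (p : Walk G v t) → through u e v ≤ᶜ dₛ u +ᶜ (w e +ᶜ walkLength G p)
        edge-bound u e v p = farkas R (+-mono-≤ R (walk-lipschitz G potₜ p) Pₜ.d[r]≤0)
          (solve 5 (λ su w tv p tt →
              ((su :+ w) :+ tv) :+ ((p :+ tt) :+ :0) ⊜ (su :+ (w :+ p)) :+ (tv :+ tt))
            ≈.refl (dₛ u) (w e) (dₜ v) (walkLength G p) (dₜ t))

        step-bound : ∀ u e v x → Joins e u v → (p : Walk G v t) → dₛ u +ᶜ (w e +ᶜ walkLength G p) ≤ᶜ x →
          dₛ v +ᶜ walkLength G p ≤ᶜ x
        step-bound u e v x j p le = farkas R (+-mono-≤ R le (Pₛ.lipschitz (Joins-sym G {e} j)))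
          (solve 5 (λ su w sv p x → (sv :+ p) :+ (x :+ (w :+ su)) ⊜ x :+ ((su :+ (w :+ p)) :+ sv))
            ≈.refl (dₛ u) (w e) (dₛ v) (walkLength G p) x)

        vertex-bound : ∀ v x (p : Walk G v t) → dₛ v +ᶜ walkLength G p ≤ᶜ x → dₛ v +ᶜ dₜ v ≤ᶜ x
        vertex-bound v x p le = farkas R (+-mono-≤ R le (+-mono-≤ R (walk-lipschitz G potₜ p) Pₜ.d[r]≤0))
          (solve 5 (λ sv p tv tt x →
              (sv :+ tv) :+ (x :+ ((p :+ tt) :+ :0)) ⊜ x :+ ((sv :+ p) :+ (tv :+ tt)))
            ≈.refl (dₛ v) (walkLength G p) (dₜ v) (dₜ t) x)

    offD-or-core : ∀ {u e v} → Joins e u v → OffD e ⊎ (¬ OffD e × Core u × Core v)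
    offD-or-core {u} {e} {v} j with offD? e j
    ... | inj₁ off       = inj₁ off
    ... | inj₂ (inj₁ uv) = inj₂ ((λ off → off j uv) , onD⇒core j uv)
    ... | inj₂ (inj₂ vu) =
      inj₂ ((λ off → off (Joins-sym G {e} j) vu) , Product.swap (onD⇒core (Joins-sym G {e} j) vu))

    -- Along edges off D both labels stay constant unless a candidate shows up,
    -- and a core vertex is its own label.
    offD-step : ∀ u e v x → Joins e u v → OffD e → (p : Walk G v t) →
      dₛ u +ᶜ (w e +ᶜ walkLength G p) ≤ᶜ x → CandidateBelow x ⊎ Lₛ.label v ≡ Lₛ.label u
    offD-step u e v x j off p le = go (Lₛ.label u Fin.≟ Lₜ.label v) (Lₛ.label v Fin.≟ Lₜ.label v)
      where
      go : Dec (Lₛ.label u ≡ Lₜ.label v) → Dec (Lₛ.label v ≡ Lₜ.label v) →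
        CandidateBelow x ⊎ Lₛ.label v ≡ Lₛ.label u
      go (no ls≢lt)  _          = inj₁ (u , e , v , candidate j off ls≢lt , O.trans (edge-bound u e v p) le)
      go (yes ls≡lt) (no ls≢lt) =
          inj₁ (vertex-candidate v x ls≢lt (vertex-bound v x p (step-bound u e v x j p le)))
      go (yes ls≡lt) (yes lv)   = inj₂ (trans lv (sym ls≡lt))

    -- The label carried along differs from every core vertex ahead. The target `t` is core and is
    -- its own label, so the label must change on the way, which only a candidate allows. An edge of
    -- D cannot occur, since its tail would be a core vertex equal to the label.
    astray⇒candidate : ∀ {u} x (p : Walk G u t) →
      (∀ {z} → z ∈ walkVertices G p → Core z → Lₛ.label u ≢ z) →
      dₛ u +ᶜ walkLength G p ≤ᶜ x → CandidateBelow x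
    astray⇒candidate x stop avoid le = contradiction (Lₛ.label-core core-t) (avoid (here refl) core-t)
    astray⇒candidate {u} x (step {v = v} e j p) avoid le = go (offD-or-core {u} {e} {v} j)
      where
      staying : CandidateBelow x ⊎ Lₛ.label v ≡ Lₛ.label u → CandidateBelow x
      staying (inj₁ found) = found
      staying (inj₂ lv≡lu) = astray⇒candidate x p
        (λ z∈p cz lv≡z → avoid (there z∈p) cz (trans (sym lv≡lu) lv≡z)) (step-bound u e v x j p le)

      go : OffD e ⊎ (¬ OffD e × Core u × Core v) → CandidateBelow x
      go (inj₁ off)          = staying (offD-step u e v x j off p le)
      go (inj₂ (_ , cu , _)) = contradiction (Lₛ.label-core {u} cu) (avoid (here refl) cu)

    -- Edges of D keep the walk in the core. At the first edge off D the walk leaves a core vertex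
    -- that is its own label, and simplicity forbids returning to it; this is the avoidance
    -- hypothesis of `astray⇒candidate`. The bound is the length of the whole path, with `dₛ u`
    -- standing for the part already traversed.
    outward-walk⇒candidate : ∀ {u e} x (p : Walk G u t) → Unique (walkVertices G p) → Core u →
      e ∈ walkEdges G p → OffD e → dₛ u +ᶜ walkLength G p ≤ᶜ x → CandidateBelow x
    outward-walk⇒candidate {u} {e} x (step {v = v} f j p) (u∉p ∷ up) cu e∈p off le =
      go e∈p (offD-or-core {u} {f} {v} j)
      where
      leaving : CandidateBelow x ⊎ Lₛ.label v ≡ Lₛ.label u → CandidateBelow x
      leaving (inj₁ found) = found
      leaving (inj₂ lv≡lu) = astray⇒candidate x p
        (λ z∈p _ lv≡z → All¬⇒¬Any u∉p
          (subst (_∈ walkVertices G p) (trans (sym lv≡z) (trans lv≡lu (Lₛ.label-core {u} cu))) z∈p))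
        (step-bound u f v x j p le)

      go : e ∈ f ∷ walkEdges G p → OffD f ⊎ (¬ OffD f × Core u × Core v) → CandidateBelow x
      go _            (inj₁ off′)         = leaving (offD-step u f v x j off′ p le)
      go (here refl)  (inj₂ (¬off , _))   = ⊥-elim (¬off off)
      go (there e∈p′) (inj₂ (_ , _ , cv)) =
          outward-walk⇒candidate x p up cv e∈p′ off (step-bound u f v x j p le)

    outward⇒candidate : (q : Path G s t) → Outward G q → CandidateBelow (length G q)
    outward⇒candidate (q , uq) (e , e∈q , ¬in) =
      outward-walk⇒candidate (walkLength G q) q uq core-s e∈q (¬InD⇒OffD ¬in)
        (farkas R Pₛ.d[r]≤0 (solve 2 (λ a b → (a :+ b) :+ :0 ⊜ b :+ a) ≈.refl (dₛ s) (walkLength G q)))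

    -- The reversed s-branch of `v` is a walk from `s` to `v`, and `dₜ` is Lipschitz along it.
    dₛ[t]≤dₛ+dₜ : ∀ v → dₛ t ≤ᶜ dₛ v +ᶜ dₜ v
    dₛ[t]≤dₛ+dₜ v = farkas R
      (+-mono-≤ R dₛ[t]≤dₜ[s] (+-mono-≤ R (walk-lipschitz G potₜ (_reverseOnto_ G b stop))
        (+-mono-≤ R (O.reflexive (walkLength-reverseOnto G b stop)) (S.branchWalk-length (S.branch v)))))
      (solve 6 (λ D ts b b′ sv tv →
          D :+ (ts :+ ((b′ :+ tv) :+ ((b :+ :0) :+ sv))) ⊜ (sv :+ tv) :+ (D :+ (ts :+ (b′ :+ b))))
        ≈.refl (dₛ t) (dₜ s) (walkLength G b) (walkLength G (_reverseOnto_ G b stop)) (dₛ v) (dₜ v))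
      where
      b = S.branchWalk (S.branch v)

    -- On the core `dₛ + dₜ` attains its minimum `dₛ t`, so a vertex no farther from `s` than a core
    -- vertex cannot be closer to `t`.
    core-antitone : ∀ y z → Core y → dₛ z ≤ᶜ dₛ y → dₜ y ≤ᶜ dₜ z
    core-antitone y z cy sz≤sy = farkas R (+-mono-≤ R cy (+-mono-≤ R (dₛ[t]≤dₛ+dₜ z) sz≤sy))
      (solve 5 (λ sy ty sz tz D → ty :+ (D :+ ((sz :+ tz) :+ sy)) ⊜ tz :+ ((sy :+ ty) :+ (D :+ sz)))
        ≈.refl (dₛ y) (dₜ y) (dₛ z) (dₜ z) (dₛ t))

    core-antitone′ : ∀ y z → Core y → dₜ z ≤ᶜ dₜ y → dₛ y ≤ᶜ dₛ z
    core-antitone′ y z cy tz≤ty = farkas R (+-mono-≤ R cy (+-mono-≤ R (dₛ[t]≤dₛ+dₜ z) tz≤ty))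
      (solve 5 (λ sy ty sz tz D → sy :+ (D :+ ((sz :+ tz) :+ ty)) ⊜ sz :+ ((sy :+ ty) :+ (D :+ tz)))
        ≈.refl (dₛ y) (dₜ y) (dₛ z) (dₜ z) (dₛ t))

    -- A candidate of minimum value gives a simple path

    IsMinimal : Fin n → Fin m → Fin n → Set (a ⊔ ℓ₂)
    IsMinimal u e v = ∀ {u′ e′ v′} → Candidate u′ e′ v′ → through u e v ≤ᶜ through u′ e′ v′

    module _ {u e v} (c : Candidate u e v) (minimal : IsMinimal u e v) where
      open Candidate c

      private
        none-below : ∀ x → ¬ (through u e v ≤ᶜ x) → ¬ CandidateBelow x
        none-below x ¬le (_ , _ , _ , c′ , le) = ¬le (O.trans (minimal c′) le)

        x y : Fin n
        x = Lₛ.label u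
        y = Lₜ.label v

        bₛ = S.branchWalk (S.branch u)
        bₜ = T.branchWalk (T.branch v)

        -- The walk s ⋯ y ⋯ v u ⋯ x ⋯ t has length reversed - (dₜ y + dₛ x).
        reversed : Carrier
        reversed = (dₛ y +ᶜ dₜ v) +ᶜ (w e +ᶜ (dₛ u +ᶜ dₜ x))

        -- As `dₛ + dₜ` equals `dₛ t` at `x` and `y`, the reversed walk exceeds `through u e v` by
        -- twice `dₛ y - dₛ x`, which is negative here. The value `r` stands for anything no larger
        -- than that walk.
        cheaper-reversed : ¬ (dₛ x ≤ᶜ dₛ y) → ∀ r → r +ᶜ (dₜ y +ᶜ dₛ x) ≤ᶜ reversed → ¬ (through u e v ≤ᶜ r)
        cheaper-reversed x≰y r r≤ thr≤r = x≰y sx≤sy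
          where
          twice : dₛ x +ᶜ dₛ x ≤ᶜ dₛ y +ᶜ dₛ y
          twice = farkas R (+-mono-≤ R (+-mono-≤ R r≤ thr≤r) (+-mono-≤ R (Lₛ.core-label u) (dₛ[t]≤dₛ+dₜ y)))
            (solve 9 (λ sx sy tx ty su w tv r D →
                (sx :+ sx) :+ ((((sy :+ tv) :+ (w :+ (su :+ tx))) :+ r) :+ (D :+ (sy :+ ty)))
              ⊜ (sy :+ sy) :+ (((r :+ (ty :+ sx)) :+ ((su :+ w) :+ tv)) :+ ((sx :+ tx) :+ D)))
              ≈.refl (dₛ x) (dₛ y) (dₜ x) (dₜ y) (dₛ u) (w e) (dₜ v) r (dₛ t))

          sx≤sy : dₛ x ≤ᶜ dₛ y
          -- Halving is replaced by totality: if `dₛ y ≤ dₛ x`, adding this to `twice` and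
          -- cancelling gives the claim anyway.
          sx≤sy = [ id , (λ sy≤sx → farkas R (+-mono-≤ R twice sy≤sx)
            (solve 2 (λ sx sy → sx :+ ((sy :+ sy) :+ sx) ⊜ sy :+ ((sx :+ sx) :+ sy)) ≈.refl (dₛ x)
                (dₛ y))) ]′
            (O.total (dₛ x) (dₛ y))

        detourₛ : dₜ u +ᶜ dₛ x ≤ᶜ dₜ x +ᶜ dₛ u
        detourₛ = Lₛ.label-detour potₜ u

        detourₜ : dₛ v +ᶜ dₜ y ≤ᶜ dₛ y +ᶜ dₜ v
        detourₜ = Lₜ.label-detour potₛ v

        -- Otherwise the reversed walk is cheaper, and one of three candidates costs no more than
        -- it: the edge taken from `v` to `u`, or one obtained at `u` or at `v` from differing
        -- labels there. If all three comparisons of labels are equalities, they chain to `x ≡ y`.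
        -- The double negation is enough because the lemma only serves to reach a contradiction.
        x-before-y : ¬ ¬ (dₛ x ≤ᶜ dₛ y)
        x-before-y x≰y = cases (Lₛ.label v Fin.≟ Lₜ.label u) (Lₛ.label u Fin.≟ Lₜ.label u)
            (Lₛ.label v Fin.≟ Lₜ.label v)
          where
          cases : Dec (Lₛ.label v ≡ Lₜ.label u) → Dec (Lₛ.label u ≡ Lₜ.label u) →
            Dec (Lₛ.label v ≡ Lₜ.label v) → ⊥
          cases (no ne) _ _ = cheaper-reversed x≰y (through v e u)
            (farkas R (+-mono-≤ R detourₛ detourₜ)
              (solve 9 (λ sv tu ty sx sy tv w su tx →
                  (((sv :+ w) :+ tu) :+ (ty :+ sx)) :+ ((tx :+ su) :+ (sy :+ tv))
                ⊜ ((sy :+ tv) :+ (w :+ (su :+ tx))) :+ ((tu :+ sx) :+ (sv :+ ty)))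
                ≈.refl (dₛ v) (dₜ u) (dₜ y) (dₛ x) (dₛ y) (dₜ v) (w e) (dₛ u) (dₜ x)))
            (minimal (candidate (Joins-sym G {e} joins) offD ne))
          cases (yes _) (no ne) _ = none-below (dₛ u +ᶜ dₜ u) (cheaper-reversed x≰y (dₛ u +ᶜ dₜ u)
            (farkas R (+-mono-≤ R (+-mono-≤ R detourₛ detourₜ) (Pₛ.lipschitz joins))
              (solve 9 (λ sv tu ty sx sy tv w su tx →
                  ((su :+ tu) :+ (ty :+ sx)) :+ (((tx :+ su) :+ (sy :+ tv)) :+ (w :+ sv))
                ⊜ ((sy :+ tv) :+ (w :+ (su :+ tx))) :+ (((tu :+ sx) :+ (sv :+ ty)) :+ su))
                ≈.refl (dₛ v) (dₜ u) (dₜ y) (dₛ x) (dₛ y) (dₜ v) (w e) (dₛ u) (dₜ x))))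
            (vertex-candidate u (dₛ u +ᶜ dₜ u) ne O.refl)
          cases (yes _) (yes _) (no ne) = none-below (dₛ v +ᶜ dₜ v) (cheaper-reversed x≰y (dₛ v +ᶜ dₜ v)
            (farkas R (+-mono-≤ R (+-mono-≤ R detourₛ detourₜ) (Pₜ.lipschitz (Joins-sym G {e} joins)))
              (solve 9 (λ sv tu ty sx sy tv w su tx →
                  ((sv :+ tv) :+ (ty :+ sx)) :+ (((tx :+ su) :+ (sy :+ tv)) :+ (w :+ tu))
                ⊜ ((sy :+ tv) :+ (w :+ (su :+ tx))) :+ (((tu :+ sx) :+ (sv :+ ty)) :+ tv))
                ≈.refl (dₛ v) (dₜ u) (dₜ y) (dₛ x) (dₛ y) (dₜ v) (w e) (dₛ u) (dₜ x))))
            (vertex-candidate v (dₛ v +ᶜ dₜ v) ne O.refl)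
          cases (yes vu) (yes uu) (yes vv) = labels (trans uu (trans (sym vu) vv))

        disjoint : ∀ z → z ∈ walkVertices G bₛ → z ∈ walkVertices G bₜ → ⊥
        disjoint z z∈bₛ z∈bₜ = cases (Lₛ.on-branch (S.branch u) z∈bₛ) (Lₜ.on-branch (T.branch v) z∈bₜ)
          where
          cases : (¬ Core z × Lₛ.label z ≡ x) ⊎ (Core z × (z ≡ x ⊎ ¬ (dₛ x ≤ᶜ dₛ z))) →
                  (¬ Core z × Lₜ.label z ≡ y) ⊎ (Core z × (z ≡ y ⊎ ¬ (dₜ y ≤ᶜ dₜ z))) → ⊥
          cases (inj₁ (¬cz , _)) (inj₂ (cz , _)) = ¬cz cz
          cases (inj₂ (cz , _)) (inj₁ (¬cz , _)) = ¬cz cz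
          cases (inj₁ (¬cz , lsz)) (inj₁ (_ , ltz)) =
            -- The labels of `z` are `x` and `y`, hence different. Since `dₛ z ≤ dₛ u` and
            -- `dₜ z ≤ dₜ v`, the candidate at `z` saves at least `w e`.
            none-below (dₛ z +ᶜ dₜ z)
              (λ le → w≰0 G e (farkas R
                (+-mono-≤ R le
                  (+-mono-≤ R (geodesic-below G potₛ bₛ (S.branchWalk-geodesic (S.branch u)) z∈bₛ)
                              (geodesic-below G potₜ bₜ (T.branchWalk-geodesic (T.branch v)) z∈bₜ)))
                (solve 5 (λ w sz tz su tv →
                    w :+ ((sz :+ tz) :+ (su :+ tv)) ⊜ :0 :+ (((su :+ w) :+ tv) :+ (sz :+ tz)))
                  ≈.refl (w e) (dₛ z) (dₜ z) (dₛ u) (dₜ v))))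
              (vertex-candidate z (dₛ z +ᶜ dₜ z) (λ eq → labels (trans (sym lsz) (trans eq ltz))) O.refl)
          -- The chain `dₛ z ≤ dₛ x ≤ dₛ y ≤ dₛ z` collapses, and the strict alternatives of
          -- `on-branch` then leave only `z ≡ x` and `z ≡ y`, against the labels being different.
          cases (inj₂ (cz , onₛ)) (inj₂ (_ , onₜ)) = x-before-y λ sx≤sy →
            labels (trans (sym (z≡x (O.trans sx≤sy sy≤sz)))
                          (z≡y (core-antitone y z (Lₜ.core-label v) (O.trans sz≤sx sx≤sy))))
            where
            z≡x : dₛ x ≤ᶜ dₛ z → z ≡ x
            z≡x le = [ id , (λ ≰ → ⊥-elim (≰ le)) ]′ onₛ

            z≡y : dₜ y ≤ᶜ dₜ z → z ≡ y
            z≡y le = [ id , (λ ≰ → ⊥-elim (≰ le)) ]′ onₜ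

            sz≤sx : dₛ z ≤ᶜ dₛ x
            sz≤sx = [ id , (λ sx≤sz → O.reflexive (≈.reflexive (cong dₛ (z≡x sx≤sz)))) ]′
                (O.total (dₛ z) (dₛ x))

            tz≤ty : dₜ z ≤ᶜ dₜ y
            tz≤ty = [ id , (λ ty≤tz → O.reflexive (≈.reflexive (cong dₜ (z≡y ty≤tz)))) ]′
                (O.total (dₜ z) (dₜ y))

            sy≤sz : dₛ y ≤ᶜ dₛ z
            sy≤sz = core-antitone′ y z (Lₜ.core-label v) tz≤ty

      treeWalk-vertices : walkVertices G (treeWalk u e v joins) ≡ walkVertices G bₛ ʳ++ walkVertices G bₜ
      treeWalk-vertices = walkVertices-reverseOnto G bₛ (step e joins bₜ)

      minimal⇒optimal : Σ[ p ∈ Path G s t ] OptimalOutward G p ×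
        vertices G p ≡ walkVertices G bₛ ʳ++ walkVertices G bₜ
      minimal⇒optimal =
        (treeWalk u e v joins , unique) ,
        ((e , treeWalk-∈ u e v joins , λ in-D → InD⇒¬OffD in-D offD) , optimal) ,
        treeWalk-vertices
        where
        unique : Unique (walkVertices G (treeWalk u e v joins))
        unique = subst Unique (sym treeWalk-vertices) (Unique-ʳ++
          (geodesic⇒Unique G potₛ bₛ (S.branchWalk-geodesic (S.branch u)))
          (geodesic⇒Unique G potₜ bₜ (T.branchWalk-geodesic (T.branch v)))
          λ { {z} (z∈bₛ , z∈bₜ) → disjoint z z∈bₛ z∈bₜ })

        optimal : (q : Path G s t) → Outward G q → walkLength G (treeWalk u e v joins) ≤ᶜ length G q
        optimal q out = let _ , _ , _ , c′ , le = outward⇒candidate q out in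
          O.trans (treeWalk-length u e v joins) (O.trans (minimal c′) le)

-- Verification rules for the word RAM

module _ {a} {A : Set a} where

  write-elim : ∀ {p} (P : A → Set p) x i v (M : Arrays A) j →
    (i ≡ j → P v) → (i ≢ j → P (M x j)) → P (write x i v M x j)
  write-elim P x i v M j eq ne rewrite dec-true (x ℕ.≟ x) refl with i ℕ.≟ j
  ... | yes i≡j rewrite dec-true (i ℕ.≟ j) i≡j = eq i≡j
  ... | no i≢j  rewrite dec-false (i ℕ.≟ j) i≢j = ne i≢j

countdown : ArrayName → Program → Program
countdown x P = while (lit 1 ≤ʷ x [ lit 0 ]) (x [ lit 0 ]≔ x [ lit 0 ] ⊖ lit 1 ⨟ P)

setWord : ∀ {a ℓ₁ ℓ₂} {R : OrderedAbelianGroup a ℓ₁ ℓ₂} → ArrayName → ℕ → State R → State R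
setWord x v σ = state (write x 0 v (State.words σ)) (State.nums σ)

module _ {a ℓ₁ ℓ₂} {R : OrderedAbelianGroup a ℓ₁ ℓ₂} (L : ℕ) where
  open OrderedAbelianGroup R using (Carrier) renaming (_≤_ to _≤ᶜ_; _≤?_ to _≤ᶜ?_)
  open State

  -- A total correctness triple with a time bound. The exact step count is hidden behind an upper
  -- estimate, so that branches of different cost share one bound.
  record Runs {q} (P : Program) (σ : State R) (T : ℕ) (Q : State R → Set q) : Set (a ⊔ q) where
    constructor runs
    field
      {final} : State R
      {time}  : ℕ
      run     : L ⊢⟨ P , σ ⟩⇓⟨ final , time ⟩
      bound   : time ≤ T
      post    : Q final

  module _ {q} {Q : State R → Set q} {σ : State R} where

    runs-weaken : ∀ {P T T′} → T ≤ T′ → Runs P σ T Q → Runs P σ T′ Q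
    runs-weaken T≤T′ (runs run τ≤T post) = runs run (ℕ.≤-trans τ≤T T≤T′) post

    runs-map : ∀ {q′} {Q′ : State R → Set q′} {P T} → (∀ {σ′} → Q σ′ → Q′ σ′) → Runs P σ T Q → Runs P σ T Q′
    runs-map f (runs run τ≤T post) = runs run τ≤T (f post)

    runs-skip : Q σ → Runs skip σ 1 Q
    runs-skip post = runs ⇓skip ℕ.≤-refl post

    runs-word : ∀ {x i j i′ j′} → evalʷ σ i ≡ i′ → evalʷ σ j ≡ j′ → Fitsʷ L σ i → Fitsʷ L σ j →
      Q (state (write x i′ j′ (words σ)) (nums σ)) → Runs (x [ i ]≔ j) σ 1 Q
    runs-word refl refl fi fj post = runs (⇓word fi fj) ℕ.≤-refl post

    runs-num : ∀ {x i p i′ p′} → evalʷ σ i ≡ i′ → evalⁿ σ p ≡ p′ → Fitsʷ L σ i → Fitsⁿ L σ p →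
      Q (state (words σ) (write x i′ p′ (nums σ))) → Runs (x [ i ]≔ⁿ p) σ 1 Q
    runs-num refl refl fi fp post = runs (⇓num fi fp) ℕ.≤-refl post

    runs-seq : ∀ {P P′ T T′} → Runs P σ T (λ σ′ → Runs P′ σ′ T′ Q) → Runs (P ⨟ P′) σ (T + T′) Q
    runs-seq (runs run τ≤T (runs run′ τ′≤T′ post)) =
      runs (⇓seq run run′) (ℕ.+-mono-≤ τ≤T τ′≤T′) post

    runs-cond : ∀ {b P P′ T} → Fitsᵗ L σ b → (evalᵗ σ b ≡ true → Runs P σ T Q) →
      (evalᵗ σ b ≡ false → Runs P′ σ T Q) → Runs (cond b P P′) σ (suc T) Q
    runs-cond {b} fb then else with evalᵗ σ b in eq
    ... | true  = let runs run τ≤T post = then refl in runs (⇓then fb eq run) (s≤s τ≤T) post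
    ... | false = let runs run τ≤T post = else refl in runs (⇓else fb eq run) (s≤s τ≤T) post

    runs-cond-word : ∀ {i j i′ j′ P P′ T} → evalʷ σ i ≡ i′ → evalʷ σ j ≡ j′ →
      Fitsʷ L σ i → Fitsʷ L σ j → (i′ ≤ j′ → Runs P σ T Q) → (¬ i′ ≤ j′ → Runs P′ σ T Q) →
      Runs (cond (i ≤ʷ j) P P′) σ (suc T) Q
    runs-cond-word {i} {j} refl refl fi fj then else with evalʷ σ i ℕ.≤? evalʷ σ j
    ... | yes i≤j = runs-cond (fi , fj) (λ _ → then i≤j)
      (λ eq → contradiction (trans (sym (dec-true (_ ℕ.≤? _) i≤j)) eq) λ ())
    ... | no i≰j = runs-cond (fi , fj)
      (λ eq → contradiction (trans (sym (dec-false (_ ℕ.≤? _) i≰j)) eq) λ ()) (λ _ → else i≰j)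

    runs-cond-num : ∀ {i j i′ j′ P P′ T} → evalⁿ σ i ≡ i′ → evalⁿ σ j ≡ j′ →
      Fitsⁿ L σ i → Fitsⁿ L σ j → (i′ ≤ᶜ j′ → Runs P σ T Q) → (¬ i′ ≤ᶜ j′ → Runs P′ σ T Q) →
      Runs (cond (i ≤ⁿ j) P P′) σ (suc T) Q
    runs-cond-num {i} {j} refl refl fi fj then else with evalⁿ σ i ≤ᶜ? evalⁿ σ j
    ... | yes i≤j = runs-cond (fi , fj) (λ _ → then i≤j)
      (λ eq → contradiction (trans (sym (dec-true (_ ≤ᶜ? _) i≤j)) eq) λ ())
    ... | no i≰j = runs-cond (fi , fj)
      (λ eq → contradiction (trans (sym (dec-false (_ ≤ᶜ? _) i≰j)) eq) λ ()) (λ _ → else i≰j)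

  -- The invariant is indexed by the number of remaining iterations and by a
  -- bound on the remaining running time.
  runs-while-budget : ∀ {i q} {Q : State R → Set q} {b P} (I : ℕ → ℕ → State R → Set i) →
    (∀ {T σ} → I 0 T σ → Fitsᵗ L σ b × evalᵗ σ b ≡ false × 1 ≤ T × Q σ) →
    (∀ {k T σ} → I (suc k) T σ → Fitsᵗ L σ b × evalᵗ σ b ≡ true ×
      ∃[ T₁ ] ∃[ T₂ ] suc (T₁ + T₂) ≤ T × Runs P σ T₁ (I k T₂)) →
    ∀ {k T σ} → I k T σ → Runs (while b P) σ T Q
  runs-while-budget I exit loop {zero} inv =
    let fb , false≡ , 1≤T , post = exit inv in runs (⇓exit fb false≡) 1≤T post
  runs-while-budget I exit loop {suc k} inv =
    let fb , true≡ , T₁ , T₂ , T₁+T₂<T , runs run τ≤T₁ inv′ = loop inv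
        runs run′ τ′≤T₂ post = runs-while-budget I exit loop inv′
    in runs (⇓loop fb true≡ run run′) (ℕ.≤-trans (s≤s (ℕ.+-mono-≤ τ≤T₁ τ′≤T₂)) T₁+T₂<T) post

  runs-while : ∀ {i q} {Q : State R → Set q} {b P} (I : ℕ → State R → Set i) c →
    (∀ {σ} → I 0 σ → Fitsᵗ L σ b × evalᵗ σ b ≡ false × Q σ) →
    (∀ {k σ} → I (suc k) σ → Fitsᵗ L σ b × evalᵗ σ b ≡ true × Runs P σ c (I k)) →
    ∀ {k σ} → I k σ → Runs (while b P) σ (1 + k * suc c) Q
  runs-while I c exit loop {k} inv = runs-while-budget (λ k T σ → T ≡ 1 + k * suc c × I k σ)
    (λ { (refl , inv) → let fb , false≡ , post = exit inv in fb , false≡ , ℕ.≤-refl , post })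
    (λ { {k} (refl , inv) → let fb , true≡ , run = loop inv in
           fb , true≡ , c , 1 + k * suc c , ℕ.≤-reflexive (cong suc (ℕ.+-suc c (k * suc c))) ,
           runs-map (refl ,_) run })
    (refl , inv)

  -- The counter is decremented before the body, which therefore sees the indices from `N - 1` down
  -- to 0 and may use the counter directly as an address. The 2 pays for the test and the decrement;
  -- the second premise says that the invariant ignores the counter.
  runs-countdown-budget : ∀ {i} {x P N} → 1 ≤ L → (J : ℕ → ℕ → State R → Set i) →
    (∀ {T σ} → J 0 T σ → 1 ≤ T) →
    (∀ {k T v σ} → J k T σ → J k T (setWord x v σ)) →
    (∀ (i : Fin N) {T σ} → words σ x 0 ≡ toℕ i → J (suc (toℕ i)) T σ →
      ∃[ T₁ ] ∃[ T₂ ] 2 + T₁ + T₂ ≤ T ×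
        Runs P σ T₁ (λ σ′ → words σ′ x 0 ≡ toℕ i × J (toℕ i) T₂ σ′)) →
    ∀ {T σ} → words σ x 0 ≡ N → J N T σ → Runs (countdown x P) σ T (λ σ′ → ∃[ T′ ] J 0 T′ σ′)
  runs-countdown-budget {x = x} {P} {N} 1≤L J positive frame body x≡N inv =
    runs-while-budget (λ k T σ → k ≤ N × words σ x 0 ≡ k × J k T σ)
      (λ (_ , x≡0 , inv) → (1≤L , z≤n) , cong (λ v → does (1 ℕ.≤? v)) x≡0 , positive inv , _ , inv)
      (λ {k} {T} {σ} (k<N , x≡ , inv) →
        let T₁ , T₂ , le , run = at {σ = setWord x k σ} k<N
                                   (write-elim (_≡ k) x 0 k (words σ) 0 (λ _ → refl)
                                       (λ ne → contradiction refl ne)) (frame inv) in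
        (1≤L , z≤n) , cong (λ v → does (1 ℕ.≤? v)) x≡ , 1 + T₁ , T₂ , le ,
        runs-seq (runs-word refl (cong (ℕ._∸ 1) x≡) z≤n (z≤n , 1≤L)
          (runs-map (λ (x≡k , inv′) → ℕ.<⇒≤ k<N , x≡k , inv′) run)))
      (ℕ.≤-refl , x≡N , inv)
    where
    at : ∀ {k T σ} → k < N → words σ x 0 ≡ k → J (suc k) T σ →
      ∃[ T₁ ] ∃[ T₂ ] 2 + T₁ + T₂ ≤ T × Runs P σ T₁ (λ σ′ → words σ′ x 0 ≡ k × J k T₂ σ′)
    at {T = T} {σ} k<N = subst
      (λ k → words σ x 0 ≡ k → J (suc k) T σ →
        ∃[ T₁ ] ∃[ T₂ ] 2 + T₁ + T₂ ≤ T × Runs P σ T₁ (λ σ′ → words σ′ x 0 ≡ k × J k T₂ σ′))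
      (Fin.toℕ-fromℕ< k<N) (body (fromℕ< k<N))

  runs-countdown : ∀ {i} {x P N} → 1 ≤ L → (J : ℕ → State R → Set i) → ∀ c →
    (∀ {k v σ} → J k σ → J k (setWord x v σ)) →
    (∀ (i : Fin N) {σ} → words σ x 0 ≡ toℕ i → J (suc (toℕ i)) σ →
      Runs P σ c (λ σ′ → words σ′ x 0 ≡ toℕ i × J (toℕ i) σ′)) →
    ∀ {σ} → words σ x 0 ≡ N → J N σ → Runs (countdown x P) σ (1 + N * (2 + c)) (J 0)
  runs-countdown 1≤L J c frame body x≡N inv =
    runs-map (λ (_ , _ , inv′) → inv′)
      (runs-countdown-budget 1≤L (λ k T σ → T ≡ 1 + k * (2 + c) × J k σ)
        (λ { (refl , _) → s≤s z≤n })
        (λ (eq , inv) → eq , frame inv)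
        (λ { i x≡i (refl , inv) → c , 1 + toℕ i * (2 + c) ,
               ℕ.≤-reflexive (cong (2 ℕ.+_) (ℕ.+-suc c (toℕ i * (2 + c)))) ,
               runs-map (λ (x≡i , inv′) → x≡i , refl , inv′) (body i x≡i inv) })
        x≡N (refl , inv))

-- The program

data Side : Set where
  S T : Side

distArray : Side → ArrayName
distArray S = 1
distArray T = 2

-- Vertex v is represented twice in the arrays 5 (parents) and 6 (labels), in
-- the cells 1 + v for the tree of s and 1 + n + v for the tree of t; 0 is nil.
-- Scalars: 10 is a loop counter, 11 and 12 are the ends of an edge, 13 and 14
-- the cells of the best candidate so far (13 is nil if there is none; its value
-- is number 3), 15 is a cursor, 16 a label or a position, 17 a saved position.
cellExp : Side → WordExp → WordExp
cellExp S i = lit 1 ⊕ i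
cellExp T i = lit 1 ⊕ (0 [ lit 0 ] ⊕ i)

throughExp : ArrayName → WordExp → ArrayName → NumExp
throughExp x i y = (1 [ x [ lit 0 ] ]ⁿ ⊕ⁿ 0 [ i ]ⁿ) ⊕ⁿ 2 [ y [ lit 0 ] ]ⁿ

dₛ[t]-exp : NumExp
dₛ[t]-exp = 1 [ 0 [ lit 3 ] ]ⁿ

-- A label is stored as 1 plus the vertex in both halves of the array, rather than as a cell of its
-- own tree, so that an s-label and a t-label are directly comparable. The value 0 means unlabelled.
initLabel : Program
initLabel =
  cond (1 [ 10 [ lit 0 ] ]ⁿ ⊕ⁿ 2 [ 10 [ lit 0 ] ]ⁿ ≤ⁿ dₛ[t]-exp)
    (6 [ cellExp S (10 [ lit 0 ]) ]≔ lit 1 ⊕ 10 [ lit 0 ] ⨟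
     6 [ cellExp T (10 [ lit 0 ]) ]≔ lit 1 ⊕ 10 [ lit 0 ])
    skip

initLabels : Program
initLabels = 10 [ lit 0 ]≔ 0 [ lit 0 ] ⨟ countdown 10 initLabel

loadEdge : Program
loadEdge =
  11 [ lit 0 ]≔ 1 [ 10 [ lit 0 ] ] ⨟ 12 [ lit 0 ]≔ 2 [ 10 [ lit 0 ] ]

-- The distances are already final, so this only records a tight arc. The parent is stored as a cell
-- of the same tree, which makes the array a linked list.
relax : Side → ArrayName → ArrayName → Program
relax a x y =
  cond (0 [ 10 [ lit 0 ] ]ⁿ ⊕ⁿ distArray a [ x [ lit 0 ] ]ⁿ ≤ⁿ distArray a [ y [ lit 0 ] ]ⁿ)
    (5 [ cellExp a (y [ lit 0 ]) ]≔ cellExp a (x [ lit 0 ]))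
    skip

relaxEdge : Program
relaxEdge = loadEdge ⨟ relax S 11 12 ⨟ relax S 12 11 ⨟ relax T 11 12 ⨟ relax T 12 11

findParents : Program
findParents =
  10 [ lit 0 ]≔ 0 [ lit 1 ] ⨟
  countdown 10 relaxEdge

findLabel : Program
findLabel = while (6 [ 15 [ lit 0 ] ] ≤ʷ lit 0) (15 [ lit 0 ]≔ 5 [ 15 [ lit 0 ] ])

markPath : Program
markPath = while (6 [ 15 [ lit 0 ] ] ≤ʷ lit 0)
  (6 [ 15 [ lit 0 ] ]≔ 16 [ lit 0 ] ⨟ 15 [ lit 0 ]≔ 5 [ 15 [ lit 0 ] ])

propagateLabel : Program
propagateLabel =
  15 [ lit 0 ]≔ lit 1 ⊕ 10 [ lit 0 ] ⨟ findLabel ⨟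
  16 [ lit 0 ]≔ 6 [ 15 [ lit 0 ] ] ⨟
  15 [ lit 0 ]≔ lit 1 ⊕ 10 [ lit 0 ] ⨟ markPath

-- One counter serves both trees: cell `1 + i` belongs to the tree of `s` for `i < n` and to the
-- tree of `t` afterwards.
propagateLabels : Program
propagateLabels = 10 [ lit 0 ]≔ 0 [ lit 0 ] ⊕ 0 [ lit 0 ] ⨟ countdown 10 propagateLabel

recordCandidate : ArrayName → ArrayName → Program
recordCandidate x y =
  13 [ lit 0 ]≔ cellExp S (x [ lit 0 ]) ⨟
  14 [ lit 0 ]≔ cellExp T (y [ lit 0 ]) ⨟
  3 [ lit 0 ]≔ⁿ throughExp x (10 [ lit 0 ]) y

challenge : ArrayName → ArrayName → Program
challenge x y =
  cond (13 [ lit 0 ] ≤ʷ lit 0) (recordCandidate x y)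
    (cond (3 [ lit 0 ]ⁿ ≤ⁿ throughExp x (10 [ lit 0 ]) y) skip (recordCandidate x y))

-- The only comparison of words is `≤`, so two labels differ when one of the two inequalities fails;
-- the challenge occurs once for each.
improve : ArrayName → ArrayName → Program
improve x y =
  cond (6 [ cellExp S (x [ lit 0 ]) ] ≤ʷ 6 [ cellExp T (y [ lit 0 ]) ])
    (cond (6 [ cellExp T (y [ lit 0 ]) ] ≤ʷ 6 [ cellExp S (x [ lit 0 ]) ]) skip (challenge x y))
    (challenge x y)

scanEdge : Program
scanEdge =
  cond (throughExp 11 (10 [ lit 0 ]) 12 ≤ⁿ dₛ[t]-exp) skip
    (cond (throughExp 12 (10 [ lit 0 ]) 11 ≤ⁿ dₛ[t]-exp) skip
      (improve 11 12 ⨟ improve 12 11))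

findCandidate : Program
findCandidate = 13 [ lit 0 ]≔ lit 0 ⨟ 10 [ lit 0 ]≔ 0 [ lit 1 ] ⨟ countdown 10 (loadEdge ⨟ scanEdge)

-- The s-branch is stored from `u` to `s` but has to be output from `s` to `u`. Its number of
-- vertices tells where writing backwards must begin.
countVertices : Program
countVertices =
  15 [ lit 0 ]≔ 13 [ lit 0 ] ⨟ 16 [ lit 0 ]≔ lit 0 ⨟
  while (lit 1 ≤ʷ 15 [ lit 0 ])
    (16 [ lit 0 ]≔ 16 [ lit 0 ] ⊕ lit 1 ⨟ 15 [ lit 0 ]≔ 5 [ 15 [ lit 0 ] ])

writeBackwards : Program
writeBackwards =
  15 [ lit 0 ]≔ 13 [ lit 0 ] ⨟ 17 [ lit 0 ]≔ 16 [ lit 0 ] ⨟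
  while (lit 1 ≤ʷ 15 [ lit 0 ])
    (16 [ lit 0 ]≔ 16 [ lit 0 ] ⊖ lit 1 ⨟
     4 [ 16 [ lit 0 ] ]≔ 15 [ lit 0 ] ⊖ lit 1 ⨟
     15 [ lit 0 ]≔ 5 [ 15 [ lit 0 ] ])

writeForwards : Program
writeForwards =
  15 [ lit 0 ]≔ 14 [ lit 0 ] ⨟ 16 [ lit 0 ]≔ 17 [ lit 0 ] ⨟
  while (lit 1 ≤ʷ 15 [ lit 0 ])
    (4 [ 16 [ lit 0 ] ]≔ 15 [ lit 0 ] ⊖ (lit 1 ⊕ 0 [ lit 0 ]) ⨟
     16 [ lit 0 ]≔ 16 [ lit 0 ] ⊕ lit 1 ⨟
     15 [ lit 0 ]≔ 5 [ 15 [ lit 0 ] ])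

outputPath : Program
outputPath =
  3 [ lit 0 ]≔ lit 0 ⨟
  cond (13 [ lit 0 ] ≤ʷ lit 0) skip
    (countVertices ⨟ writeBackwards ⨟ writeForwards ⨟ 3 [ lit 0 ]≔ 16 [ lit 0 ])

optimalOutwardPath : Program
optimalOutwardPath = initLabels ⨟ findParents ⨟ propagateLabels ⨟ findCandidate ⨟ outputPath

-- Vertex lists and their contents in memory

Unique⇒length≤ : ∀ {n} {xs : List (Fin n)} → Unique xs → List.length xs ≤ n
Unique⇒length≤ {xs = xs} unique = Fin.injective⇒≤ (lookup-injective unique _ _)
  where
  lookup-injective : ∀ {xs : List (Fin _)} → Unique xs → ∀ i j → List.lookup xs i ≡ List.lookup xs j → i ≡ j
  lookup-injective (_  ∷ _) Fin.zero    Fin.zero    _  = refl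
  lookup-injective (x∉ ∷ _) Fin.zero    (Fin.suc j) eq = contradiction eq (All.lookup x∉ (∈-lookup j))
  lookup-injective (x∉ ∷ _) (Fin.suc i) Fin.zero    eq = contradiction (sym eq) (All.lookup x∉ (∈-lookup i))
  lookup-injective (_  ∷ u) (Fin.suc i) (Fin.suc j) eq = cong Fin.suc (lookup-injective u i j eq)

-- The offset is needed for the list written from the back, whose first cell moves while it grows.
Holds : ∀ {n} → (ℕ → ℕ) → ℕ → List (Fin n) → Set
Holds M o []       = ⊤
Holds M o (x ∷ xs) = M o ≡ toℕ x × Holds M (suc o) xs

Holds-cong : ∀ {n} {M N : ℕ → ℕ} o (xs : List (Fin n)) →
  (∀ {j} → o ≤ j → j < o + List.length xs → N j ≡ M j) → Holds M o xs → Holds N o xs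
Holds-cong o []       same _         = _
Holds-cong o (x ∷ xs) same (eq , hs) =
  trans (same ℕ.≤-refl (ℕ.m<m+n o (s≤s z≤n))) eq ,
  Holds-cong (suc o) xs
      (λ o<j j< → same (ℕ.<⇒≤ o<j) (ℕ.<-≤-trans j< (ℕ.≤-reflexive (sym (ℕ.+-suc o _))))) hs

Holds-snoc : ∀ {n} {M : ℕ → ℕ} o (xs : List (Fin n)) x → Holds M o xs →
  M (o + List.length xs) ≡ toℕ x → Holds M o (xs List.∷ʳ x)
Holds-snoc {M = M} o []       x _         eq = trans (cong M (sym (ℕ.+-identityʳ o))) eq , _
Holds-snoc {M = M} o (y ∷ xs) x (eq , hs) eq′ =
  eq , Holds-snoc (suc o) xs x hs (trans (cong M (sym (ℕ.+-suc o _))) eq′)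

Holds-lookup : ∀ {n} {M : ℕ → ℕ} o (xs : List (Fin n)) → Holds M o xs →
  ∀ i → M (o + toℕ i) ≡ toℕ (List.lookup xs i)
Holds-lookup {M = M} o (x ∷ xs) (eq , _)  Fin.zero    = trans (cong M (ℕ.+-identityʳ o)) eq
Holds-lookup {M = M} o (x ∷ xs) (_  , hs) (Fin.suc i) =
  trans (cong M (ℕ.+-suc o (toℕ i))) (Holds-lookup (suc o) xs hs i)

-- Counting unlabelled cells

isZero : ℕ → ℕ
isZero zero    = 1
isZero (suc _) = 0

-- Cells are counted from 1 because cell 0 is nil and belongs to no vertex.
zeros : (ℕ → ℕ) → ℕ → ℕ
zeros M zero    = 0
zeros M (suc k) = isZero (M (suc k)) + zeros M k

zeros≤ : ∀ M k → zeros M k ≤ k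
zeros≤ M zero    = z≤n
zeros≤ M (suc k) = ℕ.+-mono-≤ (isZero≤1 (M (suc k))) (zeros≤ M k)
  where
  isZero≤1 : ∀ x → isZero x ≤ 1
  isZero≤1 zero    = ℕ.≤-refl
  isZero≤1 (suc _) = z≤n

zeros-cong : ∀ {M N} k → (∀ {i} → i ≤ k → N i ≡ M i) → zeros N k ≡ zeros M k
zeros-cong zero    eq = refl
zeros-cong (suc k) eq = cong₂ _+_ (cong isZero (eq ℕ.≤-refl)) (zeros-cong k (λ i≤k → eq (ℕ.m≤n⇒m≤1+n i≤k)))

zeros-fill : ∀ {M N : ℕ → ℕ} {i} k → M i ≡ 0 → N i ≢ 0 → 1 ≤ i → i ≤ k →
  (∀ {j} → i ≢ j → N j ≡ M j) → suc (zeros N k) ≡ zeros M k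
zeros-fill zero    M≡0 N≢0 (s≤s _) () same
zeros-fill {M} {N} {i} (suc k) M≡0 N≢0 1≤i i≤k same with i ℕ.≟ suc k
... | no i≢k rewrite same i≢k = trans (sym (ℕ.+-suc (isZero (M (suc k))) (zeros N k)))
  (cong (isZero (M (suc k)) +_) (zeros-fill k M≡0 N≢0 1≤i (ℕ.s≤s⁻¹ (ℕ.≤∧≢⇒< i≤k i≢k)) same))
... | yes refl with N (suc k)
...   | zero  = contradiction refl N≢0
...   | suc _ rewrite M≡0 = cong suc (zeros-cong k (λ j≤k → same (λ { refl → ℕ.1+n≰n j≤k })))

-- Correctness of the program

module Correctness {ℓ₀ ℓ₁ ℓ₂} {R : OrderedAbelianGroup ℓ₀ ℓ₁ ℓ₂} {n m : ℕ} (G : Graph R n m) (s t : Fin n)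
  (dₛ dₜ : Fin n → OrderedAbelianGroup.Carrier R)
  (potₛ : IsPotential G s dₛ) (potₜ : IsPotential G t dₜ)
  (L : ℕ) (3≤L : 3 ≤ L) (m≤L : m ≤ L) (n+n≤L : n + n ≤ L)
  where
  open OrderedAbelianGroup R using (Carrier; 0#; isAbelianGroup; isDecTotalOrder; _≤?_)
    renaming (_+_ to _+ᶜ_; _≤_ to _≤ᶜ_)
  open Graph G
  open State
  private
    module O = IsDecTotalOrder isDecTotalOrder

  1≤L : 1 ≤ L
  1≤L = ℕ.≤-trans (s≤s z≤n) 3≤L

  root : Side → Fin n
  root S = s
  root T = t

  dist : Side → Fin n → Carrier
  dist S = dₛ
  dist T = dₜ

  potential : ∀ a → IsPotential G (root a) (dist a)
  potential S = potₛ
  potential T = potₜ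

  cell : Side → Fin n → ℕ
  cell S v = suc (toℕ v)
  cell T v = suc (n + toℕ v)

  cell-injective : ∀ {a b u v} → cell a u ≡ cell b v → a ≡ b × u ≡ v
  cell-injective {S} {S} eq = refl , Fin.toℕ-injective (ℕ.suc-injective eq)
  cell-injective {S} {T} {u} {v} eq =
    contradiction (Fin.toℕ<n u) (ℕ.≤⇒≯ (subst (n ≤_) (sym (ℕ.suc-injective eq)) (ℕ.m≤m+n n (toℕ v))))
  cell-injective {T} {S} {u} {v} eq =
    contradiction (Fin.toℕ<n v) (ℕ.≤⇒≯ (subst (n ≤_) (ℕ.suc-injective eq) (ℕ.m≤m+n n (toℕ u))))
  cell-injective {T} {T} eq = refl , Fin.toℕ-injective (ℕ.+-cancelˡ-≡ n _ _ (ℕ.suc-injective eq))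

  cell≤n+n : ∀ a v → cell a v ≤ n + n
  cell≤n+n S v = ℕ.≤-trans (Fin.toℕ<n v) (ℕ.m≤m+n n n)
  cell≤n+n T v = ℕ.≤-trans (ℕ.≤-reflexive (sym (ℕ.+-suc n (toℕ v)))) (ℕ.+-monoʳ-≤ n (Fin.toℕ<n v))

  1≤cell : ∀ a v → 1 ≤ cell a v
  1≤cell S v = s≤s z≤n
  1≤cell T v = s≤s z≤n

  cell≤L : ∀ a v → cell a v ≤ L
  cell≤L a v = ℕ.≤-trans (cell≤n+n a v) n+n≤L

  -- Stated of the six input arrays separately, so that a write to any other array preserves it by
  -- computation.
  record IsInput (w₀ w₁ w₂ : ℕ → ℕ) (x₀ x₁ x₂ : ℕ → Carrier) : Set ℓ₀ where
    field
      n≡ : w₀ 0 ≡ n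
      m≡ : w₀ 1 ≡ m
      t≡ : w₀ 3 ≡ toℕ t
      end₁≡ : ∀ e → w₁ (toℕ e) ≡ toℕ (end₁ e)
      end₂≡ : ∀ e → w₂ (toℕ e) ≡ toℕ (end₂ e)
      w≡ : ∀ e → x₀ (toℕ e) ≡ w e
      dₛ≡ : ∀ v → x₁ (toℕ v) ≡ dₛ v
      dₜ≡ : ∀ v → x₂ (toℕ v) ≡ dₜ v

  Input : State R → Set ℓ₀
  Input σ = IsInput (words σ 0) (words σ 1) (words σ 2) (nums σ 0) (nums σ 1) (nums σ 2)

  module _ (σ : State R) (input : Input σ) where
    open IsInput input

    eval-dist : ∀ a i {v} → evalʷ σ i ≡ toℕ v → evalⁿ σ (distArray a [ i ]ⁿ) ≡ dist a v
    eval-dist S i {v} eq = trans (cong (nums σ 1) eq) (dₛ≡ v)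
    eval-dist T i {v} eq = trans (cong (nums σ 2) eq) (dₜ≡ v)

    eval-w : ∀ i {e} → evalʷ σ i ≡ toℕ e → evalⁿ σ (0 [ i ]ⁿ) ≡ w e
    eval-w i {e} eq = trans (cong (nums σ 0) eq) (w≡ e)

    eval-cell : ∀ a i {v : Fin n} → evalʷ σ i ≡ toℕ v → evalʷ σ (cellExp a i) ≡ cell a v
    eval-cell S i eq = cong suc eq
    eval-cell T i eq = cong suc (cong₂ _+_ n≡ eq)

    fits-cell : ∀ a i {v : Fin n} → evalʷ σ i ≡ toℕ v → Fitsʷ L σ i → Fitsʷ L σ (cellExp a i)
    fits-cell S i {v} eq fi = 1≤L , fi , subst (_≤ L) (sym (eval-cell S i {v} eq)) (cell≤L S v)
    fits-cell T i {v} eq fi = 1≤L ,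
      (z≤n , fi , ℕ.≤-trans (ℕ.n≤1+n _) (subst (_≤ L) (sym (eval-cell T i {v} eq)) (cell≤L T v))) ,
      subst (_≤ L) (sym (eval-cell T i {v} eq)) (cell≤L T v)

    eval-dₛ[t] : evalⁿ σ dₛ[t]-exp ≡ dₛ t
    eval-dₛ[t] = eval-dist S (0 [ lit 3 ]) t≡

  -- Initial labels of the core

  Core : Fin n → Set ℓ₂
  Core v = dₛ v +ᶜ dₜ v ≤ᶜ dₛ t

  write-both-cells : ∀ {p} (P : Side → Fin n → ℕ → Set p) x v z M →
    (∀ a → P a v z) → (∀ a u → v ≢ u → P a u (M x (cell a u))) →
    ∀ a u → P a u (write x (cell T v) z (write x (cell S v) z M) x (cell a u))
  write-both-cells P x v z M at-v away a u with v Fin.≟ u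
  ... | no v≢u = write-elim (P a u) x (cell T v) z (write x (cell S v) z M) (cell a u)
    (λ eq → contradiction (proj₂ (cell-injective {T} {a} eq)) v≢u)
    λ _ → write-elim (P a u) x (cell S v) z M (cell a u)
      (λ eq → contradiction (proj₂ (cell-injective {S} {a} eq)) v≢u) λ _ → away a u v≢u
  write-both-cells P x v z M at-v away T u | yes refl =
    write-elim (P T u) x (cell T u) z (write x (cell S u) z M) (cell T u)
      (λ _ → at-v T) (λ ne → contradiction refl ne)
  write-both-cells P x v z M at-v away S u | yes refl =
    write-elim (P S u) x (cell T u) z (write x (cell S u) z M) (cell S u)
      (λ _ → at-v S)
      λ _ → write-elim (P S u) x (cell S u) z M (cell S u) (λ _ → at-v S) (λ ne → contradiction refl ne)

  -- The counter runs downwards, so `k ≤ toℕ v` says that `v` has been visited; only then does a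
  -- zero certify that `v` is outside the core.
  InitialLabel : ℕ → Fin n → ℕ → Set ℓ₂
  InitialLabel k v z = (Core v × z ≡ suc (toℕ v)) ⊎ ((k ≤ toℕ v → ¬ Core v) × z ≡ 0)

  initLabels-runs : ∀ {σ} → Input σ → (∀ i → words σ 5 i ≡ 0) → (∀ i → words σ 6 i ≡ 0) →
    Runs L initLabels σ (1 + (1 + n * 5)) (λ σ′ → Input σ′ × (∀ i → words σ′ 5 i ≡ 0) ×
      (∀ a v → InitialLabel 0 v (words σ′ 6 (cell a v))))
  initLabels-runs {σ} inp zero₅ zero₆ =
    runs-seq L (runs-word L refl (IsInput.n≡ inp) z≤n z≤n
      (runs-countdown L 1≤L J 3 (λ inv → inv) body refl
        (inp , zero₅ , λ a v →
            inj₂ ((λ n≤v → contradiction (Fin.toℕ<n v) (ℕ.≤⇒≯ n≤v)) , zero₆ (cell a v)))))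
    where
    J : ℕ → State R → Set _
    J k σ = Input σ × (∀ i → words σ 5 i ≡ 0) × (∀ a v → InitialLabel k v (words σ 6 (cell a v)))

    other : ∀ v u z → (toℕ v ≡ toℕ u → ¬ Core u) → InitialLabel (suc (toℕ v)) u z → InitialLabel (toℕ v) u z
    other v u z _  (inj₁ core)     = inj₁ core
    other v u z nc (inj₂ (nc′ , z≡)) = inj₂ ((λ v≤u cu → nc′ (ℕ.≤∧≢⇒< v≤u (λ eq → nc eq cu)) cu) , z≡)

    body : ∀ v {σ} → words σ 10 0 ≡ toℕ v → J (suc (toℕ v)) σ →
      Runs L initLabel σ 3 (λ σ′ → words σ′ 10 0 ≡ toℕ v × J (toℕ v) σ′)
    body v {σ} x≡v (inp , zero₅ , labels) =
      runs-cond-num L (cong₂ _+ᶜ_ (eval-dist σ inp S i x≡v) (eval-dist σ inp T i x≡v)) (eval-dₛ[t] σ inp)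
        (z≤n , z≤n) 3≤L
        (λ core → runs-seq L
          (runs-word L (eval-cell σ inp S i {v} x≡v) (cong suc x≡v) (fits S) (fits S)
          (runs-word L (eval-cell σ inp T i {v} x≡v) (cong suc x≡v) (fits T) (fits S)
          (x≡v , inp , zero₅ , write-both-cells (λ _ → InitialLabel (toℕ v)) 6 v (suc (toℕ v)) (words σ)
            (λ _ → inj₁ (core , refl))
            (λ a u v≢u → other v u _ (λ eq → contradiction (Fin.toℕ-injective eq) v≢u) (labels a u))))))
        (λ ¬core → runs-weaken L (s≤s z≤n) (runs-skip L (x≡v , inp , zero₅ , λ b u →
          other v u _ (λ eq → ¬core ∘ subst Core (sym (Fin.toℕ-injective eq))) (labels b u))))
      where
      i = 10 [ lit 0 ]

      fits : ∀ a → Fitsʷ L σ (cellExp a i)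
      fits a = fits-cell σ inp a i {v} x≡v z≤n

  -- Parents from tight arcs

  Tight : Side → Fin n → Fin m → Fin n → Set ℓ₂
  Tight a v e u = w e +ᶜ dist a u ≤ᶜ dist a v

  Arcs : Set₁
  Arcs = Side → Fin n → Fin m → Fin n → Set

  -- A nil entry certifies that no arc processed so far is tight at `v`. Once every arc has been
  -- processed, nil can therefore survive only at the root.
  IsParent : Arcs → Side → Fin n → ℕ → Set ℓ₂
  IsParent Done a v z =
    (z ≡ 0 × (∀ e u → Done a v e u → Joins e v u → ¬ Tight a v e u)) ⊎
    (∃[ e ] ∃[ u ] Joins e v u × Tight a v e u × z ≡ cell a u)

  IsParent-weaken : ∀ (Done Done′ : Arcs) a v {z} → (∀ e u → Joins e v u → Done′ a v e u → Done a v e u) →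
    IsParent Done a v z → IsParent Done′ a v z
  IsParent-weaken _ _ a v sub (inj₁ (z≡0 , none)) =
    inj₁ (z≡0 , λ e u done j → none e u (sub e u j done) j)
  IsParent-weaken _ _ a v sub (inj₂ parent) = inj₂ parent

  _∪_ : Arcs → Side × Fin n × Fin m × Fin n → Arcs
  (Done ∪ arc) a v e u = Done a v e u ⊎ arc ≡ (a , v , e , u)

  InitialLabels : (ℕ → ℕ) → Set ℓ₂
  InitialLabels M = ∀ a v → InitialLabel 0 v (M (cell a v))

  loadEdge-runs : ∀ {q} {Q : State R → Set q} e {σ} → words σ 10 0 ≡ toℕ e → Input σ →
    Q (setWord 12 (toℕ (end₂ e)) (setWord 11 (toℕ (end₁ e)) σ)) →
    Runs L loadEdge σ 2 Q
  loadEdge-runs e {σ} i≡e inp post = runs-seq L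
    (runs-word L refl (trans (cong (words σ 1) i≡e) (IsInput.end₁≡ inp e)) z≤n z≤n
    (runs-word L refl (trans (cong (words σ 2) i≡e) (IsInput.end₂≡ inp e)) z≤n z≤n post))

  record Relaxed (e : Fin m) (Done : Arcs) (σ : State R) : Set (ℓ₀ ⊔ ℓ₂) where
    constructor relaxed
    field
      i≡      : words σ 10 0 ≡ toℕ e
      e₁≡     : words σ 11 0 ≡ toℕ (end₁ e)
      e₂≡     : words σ 12 0 ≡ toℕ (end₂ e)
      inp     : Input σ
      labels  : InitialLabels (words σ 6)
      parents : ∀ b z → IsParent Done b z (words σ 5 (cell b z))

  relax-runs : ∀ a x y e u v Done {σ} → words σ x 0 ≡ toℕ u → words σ y 0 ≡ toℕ v → Joins e v u →
    Relaxed e Done σ → Runs L (relax a x y) σ 2 (Relaxed e (Done ∪ (a , v , e , u)))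
  relax-runs a x y e u v Done {σ} x≡u y≡v j (relaxed i≡e e₁ e₂ inp labels parents) =
    runs-cond-num L
      (cong₂ _+ᶜ_ (eval-w σ inp (10 [ lit 0 ]) i≡e) (eval-dist σ inp a (x [ lit 0 ]) x≡u))
      (eval-dist σ inp a (y [ lit 0 ]) y≡v) (z≤n , fits-dist a x) (fits-dist a y)
      (λ tight → runs-word L (eval-cell σ inp a (y [ lit 0 ]) y≡v) (eval-cell σ inp a (x [ lit 0 ]) x≡u)
        (fits-cell σ inp a (y [ lit 0 ]) y≡v z≤n) (fits-cell σ inp a (x [ lit 0 ]) x≡u z≤n)
        (relaxed i≡e e₁ e₂ inp labels λ b z →
          write-elim (IsParent (Done ∪ (a , v , e , u)) b z) 5 (cell a v) (cell a u) (words σ) (cell b z)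
            (λ eq → written tight (cell-injective {a} {b} eq))
            (λ ne → IsParent-weaken Done (Done ∪ (a , v , e , u)) b z
              (λ { f y _ (inj₁ done) → done ; f y _ (inj₂ refl) → contradiction refl ne }) (parents b z))))
      (λ ¬tight → runs-skip L (relaxed i≡e e₁ e₂ inp labels λ b z → kept ¬tight b z (parents b z)))
    where
    fits-dist : ∀ a x → Fitsⁿ L σ (distArray a [ x [ lit 0 ] ]ⁿ)
    fits-dist S x = z≤n
    fits-dist T x = z≤n

    written : ∀ {b z} → Tight a v e u → a ≡ b × v ≡ z → IsParent (Done ∪ (a , v , e , u)) b z (cell a u)
    written tight (refl , refl) = inj₂ (e , u , j , tight , refl)

    kept : ¬ Tight a v e u → ∀ b z {c} → IsParent Done b z c → IsParent (Done ∪ (a , v , e , u)) b z c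
    kept ¬tight b z (inj₁ (c≡0 , none)) = inj₁ (c≡0 , λ
      { f y (inj₁ done) → none f y done
      ; f y (inj₂ refl) _ → ¬tight })
    kept ¬tight b z (inj₂ parent) = inj₂ parent

  UpTo : ℕ → Arcs
  UpTo k a v e u = k ≤ toℕ e

  IsParentArray : (ℕ → ℕ) → Set ℓ₂
  IsParentArray M = ∀ a v → IsParent (UpTo 0) a v (M (cell a v))

  findParents-runs : ∀ {σ} → Input σ → (∀ i → words σ 5 i ≡ 0) → InitialLabels (words σ 6) →
    Runs L findParents σ (1 + (1 + m * 12))
        (λ σ′ → Input σ′ × InitialLabels (words σ′ 6) × IsParentArray (words σ′ 5))
  findParents-runs {σ} inp zero₅ labels =
    runs-seq L (runs-word L refl (IsInput.m≡ inp) z≤n 1≤L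
      (runs-countdown L 1≤L J 10 (λ inv → inv) body refl
        (inp , labels , λ a v →
            inj₁ (zero₅ (cell a v) , λ e u m≤e → contradiction (Fin.toℕ<n e) (ℕ.≤⇒≯ m≤e)))))
    where
    J : ℕ → State R → Set _
    J k σ = Input σ × InitialLabels (words σ 6) × (∀ b z → IsParent (UpTo k) b z (words σ 5 (cell b z)))

    body : ∀ e {σ} → words σ 10 0 ≡ toℕ e → J (suc (toℕ e)) σ →
      Runs L relaxEdge σ 10 (λ σ′ → words σ′ 10 0 ≡ toℕ e × J (toℕ e) σ′)
    body e {σ} i≡e (inp , labels , parents) = runs-seq L (loadEdge-runs e i≡e inp
      (runs-seq L (runs-map L (λ r₁ →
        runs-seq L (runs-map L (λ r₂ →
          runs-seq L (runs-map L (λ r₃ →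
            runs-map L finish
              (relax-runs T 12 11 e (end₂ e) (end₁ e) _ (e₂≡ r₃) (e₁≡ r₃) (inj₁ (refl , refl)) r₃))
            (relax-runs T 11 12 e (end₁ e) (end₂ e) _ (e₁≡ r₂) (e₂≡ r₂) (inj₂ (refl , refl)) r₂)))
          (relax-runs S 12 11 e (end₂ e) (end₁ e) _ (e₂≡ r₁) (e₁≡ r₁) (inj₁ (refl , refl)) r₁)))
        (relax-runs S 11 12 e (end₁ e) (end₂ e) (UpTo (suc (toℕ e))) refl refl (inj₂ (refl , refl))
          (relaxed i≡e refl refl inp labels parents)))))
      where
      open Relaxed using (e₁≡; e₂≡)

      Done : Arcs
      Done = (((UpTo (suc (toℕ e)) ∪ (S , end₂ e , e , end₁ e)) ∪ (S , end₁ e , e , end₂ e))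
               ∪ (T , end₂ e , e , end₁ e)) ∪ (T , end₁ e , e , end₂ e)

      covered : ∀ a v f u → Joins f v u → toℕ e ≤ toℕ f → Done a v f u
      covered a v f u j e≤f with toℕ e ℕ.≟ toℕ f
      ... | no e≢f = inj₁ (inj₁ (inj₁ (inj₁ (ℕ.≤∧≢⇒< e≤f e≢f))))
      ... | yes e≡f with Fin.toℕ-injective e≡f
      covered S v f u (inj₁ (refl , refl)) _ | yes _ | refl = inj₁ (inj₁ (inj₂ refl))
      covered S v f u (inj₂ (refl , refl)) _ | yes _ | refl = inj₁ (inj₁ (inj₁ (inj₂ refl)))
      covered T v f u (inj₁ (refl , refl)) _ | yes _ | refl = inj₂ refl
      covered T v f u (inj₂ (refl , refl)) _ | yes _ | refl = inj₁ (inj₂ refl)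

      finish : ∀ {σ} → Relaxed e Done σ → words σ 10 0 ≡ toℕ e × J (toℕ e) σ
      finish (relaxed i≡e _ _ inp labels parents) = i≡e , inp , labels , λ b z →
        IsParent-weaken Done (UpTo (toℕ e)) b z (covered b z) (parents b z)

  record HasTrees (M : ℕ → ℕ) (tree : ∀ a → ShortestPathTree G (root a) (dist a)) : Set where
    field
      at-root   : ∀ a → M (cell a (root a)) ≡ 0
      at-parent : ∀ a v → v ≢ root a → M (cell a v) ≡ cell a (ShortestPathTree.parent (tree a) v)

  -- At the root a tight arc would have a length that is not positive, so the entry is nil. At every
  -- other vertex the potential guarantees a tight arc, which excludes nil. The tree is read off the
  -- memory reached by the program.
  parents⇒trees : ∀ {M} → IsParentArray M → ∃[ tree ] HasTrees M tree
  parents⇒trees {M} parents = tree , record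
    { at-root = at-root ; at-parent = λ a v v≢r → proj₂ (proj₂ (lookup a v)) v≢r }
    where
    at-root : ∀ a → M (cell a (root a)) ≡ 0
    at-root a with parents a (root a)
    ... | inj₁ (z≡0 , _) = z≡0
    ... | inj₂ (e , u , _ , tight , _) = contradiction
      (O.trans tight (O.trans (IsPotential.d[r]≤0 (potential a)) (IsPotential.0≤d (potential a) u)))
      (descent-≰′ e u)
      where
      descent-≰′ : ∀ e u → ¬ (w e +ᶜ dist a u ≤ᶜ dist a u)
      descent-≰′ e u le = descent-≰ G (potential a) {e} {u} {u} le O.refl

    lookup : ∀ a v → ∃[ u ] (v ≢ root a → ∃[ e ] Joins e v u × Tight a v e u)
        × (v ≢ root a → M (cell a v) ≡ cell a u)
    lookup a v with v Fin.≟ root a | parents a v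
    ... | yes refl | _ = v , (λ v≢r → contradiction refl v≢r) , λ v≢r → contradiction refl v≢r
    ... | no v≢r | inj₂ (e , u , j , tight , z≡) = u , (λ _ → e , j , tight) , λ _ → z≡
    ... | no v≢r | inj₁ (_ , none) =
      let e , u , j , tight = IsPotential.tight (potential a) v≢r in contradiction tight (none e u z≤n j)

    tree : ∀ a → ShortestPathTree G (root a) (dist a)
    tree a = record { parent = proj₁ ∘ lookup a ; tight = λ {v} → proj₁ (proj₂ (lookup a v)) }

  -- Propagation of labels along the trees

  module Phases (tree : ∀ a → ShortestPathTree G (root a) (dist a))
    (dₜ[s]≤dₛ[t] : dₜ s ≤ᶜ dₛ t) (dₛ[t]≤dₜ[s] : dₛ t ≤ᶜ dₜ s) where

    module Opt = OptimalOutwardPath G potₛ potₜ (tree S) (tree T) dₜ[s]≤dₛ[t] dₛ[t]≤dₜ[s]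
    module Tr a = Tree G (potential a) (tree a)

    parent : Side → Fin n → Fin n
    parent a = ShortestPathTree.parent (tree a)

    depth : Side → Fin n → ℕ
    depth a v = Tr.depth a (Tr.branch a v)

    depth-parent : ∀ a {v} → v ≢ root a → depth a (parent a v) < depth a v
    depth-parent a v≢r = ℕ.≤-reflexive (sym (Tr.depth-parent a v≢r))

    label : Side → Fin n → Fin n
    label S = Opt.Lₛ.label
    label T = Opt.Lₜ.label

    core-root : ∀ a → Core (root a)
    core-root S = Opt.core-s
    core-root T = Opt.core-t

    label-core : ∀ a {v} → Core v → label a v ≡ v
    label-core S = Opt.Lₛ.label-core
    label-core T = Opt.Lₜ.label-core

    label-parent : ∀ a {v} → v ≢ root a → ¬ Core v → label a v ≡ label a (parent a v)
    label-parent S = Opt.Lₛ.label-parent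
    label-parent T = Opt.Lₜ.label-parent

    -- The second field puts every unlabelled vertex outside the core, which is why its label may be
    -- equated with that of its parent.
    record PartialLabels (M : ℕ → ℕ) : Set ℓ₂ where
      field
        correct : ∀ a v → M (cell a v) ≢ 0 → M (cell a v) ≡ suc (toℕ (label a v))
        core≢0  : ∀ a v → Core v → M (cell a v) ≢ 0

      zero⇒¬core : ∀ a v → M (cell a v) ≡ 0 → ¬ Core v
      zero⇒¬core a v z≡0 cv = core≢0 a v cv z≡0

    initial⇒partial : ∀ {M} → InitialLabels M → PartialLabels M
    initial⇒partial labels = record
      { correct = λ a v z≢0 → case labels a v of λ
        { (inj₁ (cv , z≡)) → trans z≡ (cong (suc ∘ toℕ) (sym (label-core a cv)))
        ; (inj₂ (_ , z≡0)) → contradiction z≡0 z≢0 }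
      ; core≢0 = λ a v cv z≡0 → case labels a v of λ
        { (inj₁ (_ , z≡)) → case trans (sym z≡0) z≡ of λ ()
        ; (inj₂ (¬cv , _)) → ¬cv z≤n cv } }

    -- The index counts the unlabelled cells below the next labelled one and is the number of rounds
    -- of both inner loops.
    data Climb (M : ℕ → ℕ) (a : Side) : Fin n → ℕ → Set where
      here  : ∀ {v} → M (cell a v) ≢ 0 → Climb M a v 0
      there : ∀ {v k} → M (cell a v) ≡ 0 → v ≢ root a → Climb M a (parent a v) k → Climb M a v (suc k)

    climb : ∀ {M} → PartialLabels M → ∀ a v → ∃[ k ] Climb M a v k
    climb {M} labels a v = go (Tr.branch a v)
      where
      open PartialLabels labels

      go : ∀ {v} → Tr.Branch a v → ∃[ k ] Climb M a v k
      go Tree.root = 0 , here (core≢0 a (root a) (core-root a))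
      go (Tree.up {v} v≢r b) with M (cell a v) ℕ.≟ 0
      ... | yes z≡0 = Product.map suc (there z≡0 v≢r) (go b)
      ... | no z≢0  = 0 , here z≢0

    -- Marking a vertex changes no cell of smaller depth in the same tree, and the rest of the climb
    -- consists of such cells.
    Climb-transport : ∀ {M N a d} → (∀ {z} → depth a z < d → N (cell a z) ≡ M (cell a z)) →
      ∀ {v k} → depth a v < d → Climb M a v k → Climb N a v k
    Climb-transport same v<d (here z≢0) = here (λ N≡0 → z≢0 (trans (sym (same v<d)) N≡0))
    Climb-transport {a = a} same v<d (there z≡0 v≢r c) = there (trans (same v<d) z≡0) v≢r
      (Climb-transport same (ℕ.<-trans (depth-parent a v≢r) v<d) c)

    record Propagating (i : ℕ) (σ : State R) : Set (ℓ₀ ⊔ ℓ₂) where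
      constructor propagating
      field
        i≡      : words σ 10 0 ≡ i
        inp     : Input σ
        trees   : HasTrees (words σ 5) tree
        partial : PartialLabels (words σ 6)

    unlabelled? : ∀ (σ : State R) a v → words σ 15 0 ≡ cell a v →
      (words σ 6 (cell a v) ≡ 0 → evalᵗ σ (6 [ 15 [ lit 0 ] ] ≤ʷ lit 0) ≡ true) ×
      (words σ 6 (cell a v) ≢ 0 → evalᵗ σ (6 [ 15 [ lit 0 ] ] ≤ʷ lit 0) ≡ false)
    unlabelled? σ a v x≡ =
      (λ z≡0 → trans (cong (λ c → does (words σ 6 c ℕ.≤? 0)) x≡)
          (dec-true (_ ℕ.≤? 0) (ℕ.≤-reflexive z≡0))) ,
      (λ z≢0 → trans (cong (λ c → does (words σ 6 c ℕ.≤? 0)) x≡) (dec-false (_ ℕ.≤? 0) (z≢0 ∘ ℕ.n≤0⇒n≡0)))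

    label-preserved : ∀ {M : ℕ → ℕ} a v → v ≢ root a → M (cell a v) ≡ 0 → PartialLabels M →
      label a (parent a v) ≡ label a v
    label-preserved a v v≢r z≡0 partial =
        sym (label-parent a v≢r (PartialLabels.zero⇒¬core partial a v z≡0))

    record Finding (i : ℕ) (a : Side) (v₀ : Fin n) (k₀ U k : ℕ) (σ : State R) : Set (ℓ₀ ⊔ ℓ₂) where
      constructor finding
      field
        base      : Propagating i σ
        start     : Climb (words σ 6) a v₀ k₀
        zeros≡    : zeros (words σ 6) (n + n) ≡ U
        processed : ∀ b z → suc i < cell b z → words σ 6 (cell b z) ≢ 0
        v         : Fin n
        x≡        : words σ 15 0 ≡ cell a v
        label≡    : label a v ≡ label a v₀
        remaining : Climb (words σ 6) a v k

    findLabel-runs : ∀ {i a v₀ k₀ U k σ} → Finding i a v₀ k₀ U k σ →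
      Runs L findLabel σ (1 + k * 2) (Finding i a v₀ k₀ U 0)
    findLabel-runs {i} {a} {v₀} {k₀} {U} = runs-while L (Finding i a v₀ k₀ U) 1 exit loop
      where
      exit : ∀ {σ} → Finding i a v₀ k₀ U 0 σ → _
      exit {σ} inv@(finding _ _ _ _ v x≡ _ (here z≢0)) =
          (z≤n , z≤n) , proj₂ (unlabelled? σ a v x≡) z≢0 , inv

      loop : ∀ {k σ} → Finding i a v₀ k₀ U (suc k) σ →
        Fitsᵗ L σ (6 [ 15 [ lit 0 ] ] ≤ʷ lit 0) × evalᵗ σ (6 [ 15 [ lit 0 ] ] ≤ʷ lit 0) ≡ true ×
        Runs L (15 [ lit 0 ]≔ 5 [ 15 [ lit 0 ] ]) σ 1 (Finding i a v₀ k₀ U k)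
      loop {k} {σ} (finding (propagating i≡ inp trees partial) start zeros≡ processed v x≡ label≡
          (there z≡0 v≢r c)) =
        (z≤n , z≤n) , proj₁ (unlabelled? σ a v x≡) z≡0 ,
        runs-word L refl (trans (cong (words σ 5) x≡) (HasTrees.at-parent trees a v v≢r)) z≤n z≤n
          (finding (propagating i≡ inp trees partial) start zeros≡ processed (parent a v) refl
            (trans (label-preserved a v v≢r z≡0 partial) label≡) c)

    -- `filled` links time to progress: at the exit it equals the climb length `k₀`, and `zeros≡`
    -- says that the number of unlabelled cells has dropped by just that much. `v₀-marked` keeps the
    -- cursor at the start until the start is labelled, so that after the loop the starting cell is
    -- known to be nonzero.
    record Marking (i : ℕ) (a : Side) (v₀ : Fin n) (k₀ U k : ℕ) (σ : State R) : Set (ℓ₀ ⊔ ℓ₂) where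
      constructor marking
      field
        base      : Propagating i σ
        filled    : ℕ
        filled≡   : filled + k ≡ k₀
        zeros≡    : filled + zeros (words σ 6) (n + n) ≡ U
        processed : ∀ b z → suc i < cell b z → words σ 6 (cell b z) ≢ 0
        v         : Fin n
        x≡        : words σ 15 0 ≡ cell a v
        label≡    : label a v ≡ label a v₀
        r≡        : words σ 16 0 ≡ suc (toℕ (label a v₀))
        remaining : Climb (words σ 6) a v k
        v₀-marked : words σ 6 (cell a v₀) ≡ 0 → v ≡ v₀

    markPath-runs : ∀ {i a v₀ k₀ U k σ} → Marking i a v₀ k₀ U k σ →
      Runs L markPath σ (1 + k * 3) (Marking i a v₀ k₀ U 0)
    markPath-runs {i} {a} {v₀} {k₀} {U} = runs-while L (Marking i a v₀ k₀ U) 2 exit loop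
      where
      exit : ∀ {σ} → Marking i a v₀ k₀ U 0 σ → _
      exit {σ} inv@(marking _ _ _ _ _ v x≡ _ _ (here z≢0) _) =
          (z≤n , z≤n) , proj₂ (unlabelled? σ a v x≡) z≢0 , inv

      loop : ∀ {k σ} → Marking i a v₀ k₀ U (suc k) σ →
        Fitsᵗ L σ (6 [ 15 [ lit 0 ] ] ≤ʷ lit 0) × evalᵗ σ (6 [ 15 [ lit 0 ] ] ≤ʷ lit 0) ≡ true ×
        Runs L (6 [ 15 [ lit 0 ] ]≔ 16 [ lit 0 ] ⨟ 15 [ lit 0 ]≔ 5 [ 15 [ lit 0 ] ]) σ 2
            (Marking i a v₀ k₀ U k)
      loop {k} {σ} (marking
          (propagating i≡ inp trees partial) filled filled≡ zeros≡ processed v x≡ label≡ r≡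
              (there z≡0 v≢r c) v₀-marked) =
        (z≤n , z≤n) , proj₁ (unlabelled? σ a v x≡) z≡0 ,
        runs-seq L (runs-word L x≡ r≡ z≤n z≤n
          (runs-word L refl (trans (cong (words σ 5) x≡) (HasTrees.at-parent trees a v v≢r)) z≤n z≤n
            (marking (propagating i≡ inp trees partial′) (suc filled)
              (trans (sym (ℕ.+-suc filled k)) filled≡)
              (trans (trans (sym (ℕ.+-suc filled _)) (cong (filled +_) fill)) zeros≡)
              (λ b z i<z → nonzero (cell b z) (processed b z i<z))
              (parent a v) refl (trans (label-preserved a v v≢r z≡0 partial) label≡) r≡
              (Climb-transport (λ {z} z<v → elsewhere (cell a z)
                  (λ eq → ℕ.<⇒≢ z<v (cong (depth a) (sym (proj₂ (cell-injective {a} {a} eq))))))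
                (depth-parent a v≢r) c)
              (λ N≡0 → contradiction N≡0 v₀-nonzero))))
        where
        r = suc (toℕ (label a v₀))

        N : ℕ → ℕ
        N = write 6 (cell a v) r (words σ) 6

        at-v : ∀ c → cell a v ≡ c → N c ≡ r
        at-v c eq = write-elim (_≡ r) 6 (cell a v) r (words σ) c (λ _ → refl) (contradiction eq)

        elsewhere : ∀ c → cell a v ≢ c → N c ≡ words σ 6 c
        elsewhere c ne = write-elim (_≡ words σ 6 c) 6 (cell a v) r (words σ) c
            (λ eq → contradiction eq ne) (λ _ → refl)

        nonzero : ∀ c → words σ 6 c ≢ 0 → N c ≢ 0
        nonzero c z≢0 = write-elim (_≢ 0) 6 (cell a v) r (words σ) c (λ _ ()) (λ _ → z≢0)

        fill : suc (zeros N (n + n)) ≡ zeros (words σ 6) (n + n)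
        fill = zeros-fill (n + n) z≡0 (λ N≡0 → case trans (sym N≡0) (at-v _ refl) of λ ()) (1≤cell a v)
          (cell≤n+n a v) (λ {c} → elsewhere c)

        v₀-nonzero : N (cell a v₀) ≢ 0
        v₀-nonzero with v Fin.≟ v₀
        ... | yes refl = λ N≡0 → case trans (sym N≡0) (at-v _ refl) of λ ()
        ... | no v≢v₀ = nonzero (cell a v₀) (v≢v₀ ∘ v₀-marked)

        partial′ : PartialLabels N
        partial′ = record
          { correct = λ b z → write-elim (λ c → c ≢ 0 → c ≡ suc (toℕ (label b z))) 6 (cell a v) r (words σ)
              (cell b z)
              (λ eq _ → relabel b z (cell-injective {a} {b} eq)) (λ _ → PartialLabels.correct partial b z)
          ; core≢0 = λ b z cz → nonzero (cell b z) (PartialLabels.core≢0 partial b z cz) }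
          where
          relabel : ∀ b z → a ≡ b × v ≡ z → r ≡ suc (toℕ (label b z))
          relabel b z (refl , refl) = cong (suc ∘ toℕ) (sym label≡)

    decode : (i : Fin (n + n)) → ∃[ a ] ∃[ v ] suc (toℕ i) ≡ cell a v
    decode i with Fin.splitAt n i in eq
    ... | inj₁ v = S , v , cong suc (trans (cong toℕ (sym (Fin.splitAt⁻¹-↑ˡ eq))) (Fin.toℕ-↑ˡ v n))
    ... | inj₂ v = T , v , cong suc (trans (cong toℕ (sym (Fin.splitAt⁻¹-↑ʳ eq))) (Fin.toℕ-↑ʳ n v))

    record Labelled (M : ℕ → ℕ) : Set where
      field
        label≡ : ∀ a v → M (cell a v) ≡ suc (toℕ (label a v))

    -- Each iteration of the two inner loops is paid for by a cell that stops being zero.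
    propagateLabels-runs : ∀ {σ} → Input σ → InitialLabels (words σ 6) → HasTrees (words σ 5) tree →
      Runs L propagateLabels σ (1 + (1 + (n + n) * 7 + (n + n) * 5))
        (λ σ′ → Input σ′ × HasTrees (words σ′ 5) tree × Labelled (words σ′ 6))
    propagateLabels-runs {σ} inp labels trees =
      runs-seq L (runs-word L refl (cong₂ _+_ (IsInput.n≡ inp) (IsInput.n≡ inp)) z≤n
          (z≤n , z≤n , subst (_≤ L) (sym (cong₂ _+_ (IsInput.n≡ inp) (IsInput.n≡ inp))) n+n≤L)
        (runs-weaken L (ℕ.+-monoʳ-≤ (1 + (n + n) * 7) (ℕ.*-monoˡ-≤ 5 (zeros≤ (words σ 6) (n + n))))
          (runs-map L (λ {σ′} → finish {σ′})
              (runs-countdown-budget L 1≤L J (λ (eq , _) → subst (1 ≤_) (sym eq) (s≤s z≤n))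
                  (λ inv → inv) body refl
            (refl , inp , trees , initial⇒partial labels , λ a v n<c →
                contradiction (cell≤n+n a v) (ℕ.<⇒≱ n<c))))))
      where
      J : ℕ → ℕ → State R → Set (ℓ₀ ⊔ ℓ₂)
      -- A cell that is climbed costs 2 steps in `findLabel` and 3 in `markPath`, hence the 5. The 7
      -- are the remaining steps of one outer round, including test and decrement.
      J k B σ = B ≡ 1 + k * 7 + zeros (words σ 6) (n + n) * 5 × Input σ × HasTrees (words σ 5) tree ×
        PartialLabels (words σ 6) × (∀ a v → k < cell a v → words σ 6 (cell a v) ≢ 0)

      finish : ∀ {σ} → ∃[ T′ ] J 0 T′ σ → Input σ × HasTrees (words σ 5) tree × Labelled (words σ 6)
      finish (_ , _ , inp , trees , partial , processed) = inp , trees , record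
        { label≡ = λ { S v → PartialLabels.correct partial S v (processed S v (s≤s z≤n))
                     ; T v → PartialLabels.correct partial T v (processed T v (s≤s z≤n)) } }

      propagate : ∀ (i : Fin (n + n)) a v → suc (toℕ i) ≡ cell a v → ∀ {k U σ} → Climb (words σ 6) a v k →
        zeros (words σ 6) (n + n) ≡ U → Propagating (toℕ i) σ →
        (∀ b z → suc (toℕ i) < cell b z → words σ 6 (cell b z) ≢ 0) →
        Runs L propagateLabel σ (1 + ((1 + k * 2) + (1 + (1 + (1 + k * 3))))) (Marking (toℕ i) a v k U 0)
      propagate i a v i≡v {k} {U} {σ} c zeros≡ (propagating i≡ inp trees partial) processed =
        runs-seq L (runs-word L refl (trans (cong suc i≡) i≡v) z≤n
            (1≤L , z≤n , ℕ.≤-trans (ℕ.≤-reflexive (trans (cong suc i≡) i≡v)) (cell≤L a v))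
          (runs-seq L (runs-map L mark (findLabel-runs
            (finding (propagating i≡ inp trees partial) c zeros≡ processed v refl refl c)))))
        where
        mark : ∀ {σ} → Finding (toℕ i) a v k U 0 σ →
            Runs L _ σ (1 + (1 + (1 + k * 3))) (Marking (toℕ i) a v k U 0)
        mark {σ} (finding (propagating i≡ inp trees partial) start zeros≡ processed x x≡ label≡
            (here z≢0)) =
          runs-seq L (runs-word L refl
              (trans (cong (words σ 6) x≡)
                  (trans (PartialLabels.correct partial a x z≢0) (cong (suc ∘ toℕ) label≡))) z≤n z≤n
            (runs-seq L (runs-word L refl (trans (cong suc i≡) i≡v) z≤n
                (1≤L , z≤n , ℕ.≤-trans (ℕ.≤-reflexive (trans (cong suc i≡) i≡v)) (cell≤L a v))
              (markPath-runs (marking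
                  (propagating i≡ inp trees partial) 0 refl zeros≡ processed v refl refl refl start
                      (λ _ → refl))))))

      body : ∀ (i : Fin (n + n)) {B σ} → words σ 10 0 ≡ toℕ i → J (suc (toℕ i)) B σ →
        ∃[ T₁ ] ∃[ T₂ ] 2 + T₁ + T₂ ≤ B ×
          Runs L propagateLabel σ T₁ (λ σ′ → words σ′ 10 0 ≡ toℕ i × J (toℕ i) T₂ σ′)
      body i {σ = σ} i≡ (B≡ , inp , trees , partial , processed) =
        let a , v , i≡v = decode i
            k , c = climb partial a v
            run = propagate i a v i≡v c refl (propagating i≡ inp trees partial) processed
            -- How much budget remains depends on the number of cells this round has filled, so it
            -- is measured in the final state of the run.
            U′ = zeros (words (Runs.final run) 6) (n + n)
        in _ , 1 + toℕ i * 7 + U′ * 5 ,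
           ℕ.≤-reflexive (trans (budget (toℕ i) k U′ (spent (Runs.post run))) (sym B≡)) ,
           keep run i≡v
        where
        spent : ∀ {a v k U σ} → Marking (toℕ i) a v k U 0 σ → k + zeros (words σ 6) (n + n) ≡ U
        spent (marking _ f f≡ z≡ _ _ _ _ _ _ _) = trans (cong (_+ _) (trans (sym f≡) (ℕ.+-identityʳ f))) z≡

        budget : ∀ i k U′ {U} → k + U′ ≡ U →
          2 + (1 + ((1 + k * 2) + (1 + (1 + (1 + k * 3))))) + (1 + i * 7 + U′ * 5) ≡ 1 + suc i * 7 + U * 5
        budget i k U′ refl = identity i k U′
          where
          identity : ∀ i k U′ → 2 + (1 + ((1 + k * 2) + (1 + (1 + (1 + k * 3))))) + (1 + i * 7 + U′ * 5)
            ≡ 1 + suc i * 7 + (k + U′) * 5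
          identity = solve-∀

        keep : ∀ {a v k U B σ} (run : Runs L propagateLabel σ B (Marking (toℕ i) a v k U 0)) →
            suc (toℕ i) ≡ cell a v →
          Runs L propagateLabel σ B (λ σ′ → words σ′ 10 0 ≡ toℕ i ×
            J (toℕ i) (1 + toℕ i * 7 + zeros (words (Runs.final run) 6) (n + n) * 5) σ′)
        keep {a} {v} (runs {σ′} run bound
            (marking (propagating i≡ inp trees partial) _ _ _ processed x _ _ _ (here x≢0) v₀-marked)) i≡v =
          runs run bound (i≡ , refl , inp , trees , partial , λ b z i<z z≡0 →
            case (suc (toℕ i) ℕ.≟ cell b z) of λ
              { (yes eq) → at-i b z (cell-injective {a} {b} (trans (sym i≡v) eq)) z≡0
              ; (no ne) → processed b z (ℕ.≤∧≢⇒< i<z ne) z≡0 })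
          where
          at-i : ∀ b z → a ≡ b × v ≡ z → words σ′ 6 (cell b z) ≢ 0
          at-i b z (refl , refl) z≡0 = x≢0 (trans (cong (words σ′ 6 ∘ cell a) (v₀-marked z≡0)) z≡0)

    -- Search for a candidate of minimum value

    Triples : Set₁
    Triples = Fin n → Fin m → Fin n → Set

    _∪₁_ : Triples → Fin n × Fin m × Fin n → Triples
    (Done ∪₁ arc) u e v = Done u e v ⊎ arc ≡ (u , e , v)

    Best : Triples → ℕ → ℕ → Carrier → Set (ℓ₀ ⊔ ℓ₂)
    Best Done b₁ b₂ x =
      (b₁ ≡ 0 × (∀ u e v → Done u e v → ¬ Opt.Candidate u e v)) ⊎
      (∃[ u ] ∃[ e ] ∃[ v ] Opt.Candidate u e v × b₁ ≡ cell S u × b₂ ≡ cell T v × x ≡ Opt.through u e v ×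
        (∀ u′ e′ v′ → Done u′ e′ v′ → Opt.Candidate u′ e′ v′ → Opt.through u e v ≤ᶜ Opt.through u′ e′ v′))

    Best-weaken : ∀ Done Done′ {b₁ b₂ x} → (∀ u e v → Opt.Candidate u e v → Done′ u e v → Done u e v) →
      Best Done b₁ b₂ x → Best Done′ b₁ b₂ x
    Best-weaken _ _ sub (inj₁ (b≡0 , none)) = inj₁ (b≡0 , λ u e v done c → none u e v (sub u e v c done) c)
    Best-weaken _ _ sub (inj₂ (u , e , v , c , b₁≡ , b₂≡ , x≡ , least)) =
      inj₂ (u , e , v , c , b₁≡ , b₂≡ , x≡ , λ u′ e′ v′ done c′ → least u′ e′ v′ (sub u′ e′ v′ c′ done) c′)

    record Scanned (e : Fin m) (Done : Triples) (σ : State R) : Set (ℓ₀ ⊔ ℓ₂) where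
      constructor scanned
      field
        i≡       : words σ 10 0 ≡ toℕ e
        e₁≡      : words σ 11 0 ≡ toℕ (end₁ e)
        e₂≡      : words σ 12 0 ≡ toℕ (end₂ e)
        inp      : Input σ
        trees    : HasTrees (words σ 5) tree
        labelled : Labelled (words σ 6)
        best     : Best Done (words σ 13 0) (words σ 14 0) (nums σ 3 0)

    eval-through : ∀ σ → Input σ → ∀ x y {u e v} → words σ 10 0 ≡ toℕ e → words σ x 0 ≡ toℕ u →
        words σ y 0 ≡ toℕ v →
      evalⁿ σ (throughExp x (10 [ lit 0 ]) y) ≡ Opt.through u e v
    eval-through σ inp x y i≡ x≡ y≡ =
      cong₂ _+ᶜ_ (cong₂ _+ᶜ_ (eval-dist σ inp S (x [ lit 0 ]) x≡) (eval-w σ inp (10 [ lit 0 ]) i≡))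
        (eval-dist σ inp T (y [ lit 0 ]) y≡)

    -- For a variable array name `write` does not compute, so independence from the two arrays
    -- recording the best candidate is passed as equations.
    Preserved : ArrayName → Set
    Preserved x = (∀ i z (M : Arrays ℕ) → write 13 i z M x 0 ≡ M x 0) ×
                  (∀ i z (M : Arrays ℕ) → write 14 i z M x 0 ≡ M x 0)

    module _ (x y : ArrayName) (keepˣ : Preserved x) (keepʸ : Preserved y)
             (u v : Fin n) (e : Fin m) (Done : Triples) where

      private
        Done′ : Triples
        Done′ = Done ∪₁ (u , e , v)

        i = 10 [ lit 0 ]

      recordCandidate-runs : ∀ {σ} → words σ x 0 ≡ toℕ u → words σ y 0 ≡ toℕ v → Scanned e Done σ →
        Opt.Candidate u e v →
        (∀ u′ e′ v′ → Done u′ e′ v′ → Opt.Candidate u′ e′ v′ → Opt.through u e v ≤ᶜ Opt.through u′ e′ v′) →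
        Runs L (recordCandidate x y) σ 3 (Scanned e Done′)
      recordCandidate-runs {σ} x≡u y≡v (scanned i≡ e₁≡ e₂≡ inp trees labelled best) c least =
        runs-seq L (runs-word L (refl {x = 0}) (eval-cell σ inp S (x [ lit 0 ]) x≡u) z≤n
            (fits-cell σ inp S (x [ lit 0 ]) x≡u z≤n)
        (runs-seq L (runs-word L (refl {x = 0}) (eval-cell σ₁ inp T (y [ lit 0 ]) y≡v₁) z≤n
            (fits-cell σ₁ inp T (y [ lit 0 ]) y≡v₁ z≤n)
        (runs-num L (refl {x = 0}) (eval-through σ₂ inp x y i≡ x≡u₂ y≡v₂) z≤n ((z≤n , z≤n) , z≤n)
        (scanned i≡ e₁≡ e₂≡ inp trees labelled
          (inj₂ (u , e , v , c , refl , refl , refl , λ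
            { u′ e′ v′ (inj₁ done) c′ → least u′ e′ v′ done c′
            ; _ _ _ (inj₂ refl) _ → O.refl })))))))
        where
        σ₁ σ₂ : State R
        σ₁ = setWord 13 (cell S u) σ
        σ₂ = setWord 14 (cell T v) σ₁

        y≡v₁ : words σ₁ y 0 ≡ toℕ v
        y≡v₁ = trans (proj₁ keepʸ 0 (cell S u) (words σ)) y≡v

        y≡v₂ : words σ₂ y 0 ≡ toℕ v
        y≡v₂ = trans (proj₂ keepʸ 0 (cell T v) (words σ₁)) y≡v₁

        x≡u₂ : words σ₂ x 0 ≡ toℕ u
        x≡u₂ = trans (proj₂ keepˣ 0 (cell T v) (words σ₁)) (trans (proj₁ keepˣ 0 (cell S u) (words σ)) x≡u)

      challenge-runs : ∀ {σ} → words σ x 0 ≡ toℕ u → words σ y 0 ≡ toℕ v → Scanned e Done σ →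
        Opt.Candidate u e v → Runs L (challenge x y) σ 5 (Scanned e Done′)
      challenge-runs {σ} x≡u y≡v sc@(scanned i≡ e₁≡ e₂≡ inp trees labelled best) c =
        runs-cond-word L {Q = Scanned e Done′} (refl {x = words σ 13 0}) (refl {x = 0}) z≤n z≤n
          (λ ≤0 → runs-weaken L (ℕ.n≤1+n 3) (recordCandidate-runs x≡u y≡v sc c (first ≤0 best)))
          (λ ≰0 → runs-cond-num L {Q = Scanned e Done′} (refl {x = nums σ 3 0})
              (eval-through σ inp x y i≡ x≡u y≡v) z≤n ((z≤n , z≤n) , z≤n)
            (λ best≤ → runs-weaken L (s≤s z≤n)
                (runs-skip L (scanned i≡ e₁≡ e₂≡ inp trees labelled (keep ≰0 best best≤))))
            (λ best≰ → recordCandidate-runs x≡u y≡v sc c (better ≰0 best best≰)))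
        where
        Least : Set _
        Least = ∀ u′ e′ v′ → Done u′ e′ v′ → Opt.Candidate u′ e′ v′ →
            Opt.through u e v ≤ᶜ Opt.through u′ e′ v′

        first : ∀ {b₁ b₂ x} → b₁ ≤ 0 → Best Done b₁ b₂ x → Least
        first ≤0 (inj₁ (_ , none)) u′ e′ v′ done c′ = contradiction c′ (none u′ e′ v′ done)
        first ≤0 (inj₂ (_ , _ , _ , _ , refl , _)) = contradiction ≤0 λ ()

        better : ∀ {b₁ b₂ x} → ¬ b₁ ≤ 0 → Best Done b₁ b₂ x → ¬ (x ≤ᶜ Opt.through u e v) → Least
        better ≰0 (inj₁ (refl , _)) _ = contradiction z≤n ≰0
        better ≰0 (inj₂ (_ , _ , _ , _ , _ , _ , refl , least)) best≰ u′ e′ v′ done c′ =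
          O.trans ([ id , (λ le → contradiction le best≰) ]′ (O.total _ _)) (least u′ e′ v′ done c′)

        keep : ∀ {b₁ b₂ x} → ¬ b₁ ≤ 0 → Best Done b₁ b₂ x → x ≤ᶜ Opt.through u e v → Best Done′ b₁ b₂ x
        keep ≰0 (inj₁ (refl , _)) _ = contradiction z≤n ≰0
        keep ≰0 (inj₂ (u₁ , e₁ , v₁ , c₁ , b₁≡ , b₂≡ , refl , least)) best≤ =
          inj₂ (u₁ , e₁ , v₁ , c₁ , b₁≡ , b₂≡ , refl , λ
            { u′ e′ v′ (inj₁ done) c′ → least u′ e′ v′ done c′
            ; _ _ _ (inj₂ refl) _ → best≤ })

      improve-runs : ∀ {σ} → words σ x 0 ≡ toℕ u → words σ y 0 ≡ toℕ v → Joins e u v → Opt.OffD e →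
        Scanned e Done σ → Runs L (improve x y) σ 7 (Scanned e Done′)
      improve-runs {σ} x≡u y≡v j off sc@(scanned i≡ e₁≡ e₂≡ inp trees labelled best) =
        runs-cond-word L {Q = Scanned e Done′} eval-u eval-v fits-u fits-v
          (λ le → runs-cond-word L {Q = Scanned e Done′} eval-v eval-u fits-v fits-u
            (λ ge → runs-weaken L (s≤s z≤n) (runs-skip L (scanned i≡ e₁≡ e₂≡ inp trees labelled
              (Best-weaken Done Done′ (λ
                { _ _ _ _ (inj₁ done) → done
                ; _ _ _ c (inj₂ refl) →
                    contradiction (Fin.toℕ-injective (ℕ.suc-injective (ℕ.≤-antisym le ge)))
                                          (Opt.Candidate.labels c) }) best))))
            (λ ≱ → challenge-runs x≡u y≡v sc
                (Opt.candidate j off (λ eq → ≱ (ℕ.≤-reflexive (cong (suc ∘ toℕ) (sym eq)))))))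
          (λ ≰ → runs-weaken L (ℕ.n≤1+n 5)
            (challenge-runs x≡u y≡v sc
                (Opt.candidate j off (λ eq → ≰ (ℕ.≤-reflexive (cong (suc ∘ toℕ) eq))))))
        where
        eval-u : evalʷ σ (6 [ cellExp S (x [ lit 0 ]) ]) ≡ suc (toℕ (label S u))
        eval-u = trans (cong (words σ 6) (eval-cell σ inp S (x [ lit 0 ]) x≡u))
            (Labelled.label≡ labelled S u)

        eval-v : evalʷ σ (6 [ cellExp T (y [ lit 0 ]) ]) ≡ suc (toℕ (label T v))
        eval-v = trans (cong (words σ 6) (eval-cell σ inp T (y [ lit 0 ]) y≡v))
            (Labelled.label≡ labelled T v)

        fits-u : Fitsʷ L σ (cellExp S (x [ lit 0 ]))
        fits-u = fits-cell σ inp S (x [ lit 0 ]) x≡u z≤n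

        fits-v : Fitsʷ L σ (cellExp T (y [ lit 0 ]))
        fits-v = fits-cell σ inp T (y [ lit 0 ]) y≡v z≤n

    UpTo₁ : ℕ → Triples
    UpTo₁ k u e v = k ≤ toℕ e

    findCandidate-runs : ∀ {σ} → Input σ → HasTrees (words σ 5) tree → Labelled (words σ 6) →
      Runs L findCandidate σ (1 + (1 + (1 + m * 20)))
        (λ σ′ → Input σ′ × HasTrees (words σ′ 5) tree ×
            Best (UpTo₁ 0) (words σ′ 13 0) (words σ′ 14 0) (nums σ′ 3 0))
    findCandidate-runs {σ} inp trees labelled =
      runs-seq L (runs-word L refl refl z≤n z≤n
        (runs-seq L (runs-word L refl (IsInput.m≡ inp) z≤n 1≤L
          (runs-map L (λ (inp , trees , _ , best) → inp , trees , best)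
            (runs-countdown L 1≤L J 18 (λ inv → inv) body refl
              (inp , trees , labelled ,
               inj₁ (refl , λ u e v m≤e _ → contradiction (Fin.toℕ<n e) (ℕ.≤⇒≯ m≤e))))))))
      where
      J : ℕ → State R → Set (ℓ₀ ⊔ ℓ₂)
      J k σ = Input σ × HasTrees (words σ 5) tree × Labelled (words σ 6) ×
        Best (UpTo₁ k) (words σ 13 0) (words σ 14 0) (nums σ 3 0)

      onD-done : ∀ e {b₁ b₂ x} → ¬ Opt.OffD e → Best (UpTo₁ (suc (toℕ e))) b₁ b₂ x →
          Best (UpTo₁ (toℕ e)) b₁ b₂ x
      onD-done e on = Best-weaken _ _ (λ u f v c e≤f → ℕ.≤∧≢⇒< e≤f
        (λ eq → on (subst Opt.OffD (sym (Fin.toℕ-injective eq)) (Opt.Candidate.offD c))))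

      preserved₁₁ : Preserved 11
      preserved₁₁ = (λ _ _ _ → refl) , (λ _ _ _ → refl)

      preserved₁₂ : Preserved 12
      preserved₁₂ = (λ _ _ _ → refl) , (λ _ _ _ → refl)

      scan : ∀ e {σ} → Scanned e (UpTo₁ (suc (toℕ e))) σ →
        Runs L scanEdge σ 16 (λ σ′ → words σ′ 10 0 ≡ toℕ e × J (toℕ e) σ′)
      scan e {σ} sc@(scanned i≡ e₁≡ e₂≡ inp trees labelled best) =
        runs-cond-num L (eval-through σ inp 11 12 i≡ e₁≡ e₂≡) (eval-dₛ[t] σ inp) ((z≤n , z≤n) , z≤n) 3≤L
          (λ on → runs-weaken L (s≤s z≤n) (runs-skip L
            (i≡ , inp , trees , labelled , onD-done e (λ off → off joins on) best)))
          (λ off₁ → runs-cond-num L (eval-through σ inp 12 11 i≡ e₂≡ e₁≡) (eval-dₛ[t] σ inp)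
              ((z≤n , z≤n) , z≤n) 3≤L
            (λ on → runs-weaken L (s≤s z≤n) (runs-skip L
              (i≡ , inp , trees , labelled , onD-done e (λ off → off (Joins-sym G {e} joins) on) best)))
            (λ off₂ → runs-seq L (runs-map L (λ sc₁ → runs-map L finish
                (improve-runs 12 11 preserved₁₂ preserved₁₁ (end₂ e) (end₁ e) e _
                  (Scanned.e₂≡ sc₁) (Scanned.e₁≡ sc₁) (Joins-sym G {e} joins) (offD off₁ off₂) sc₁))
              (improve-runs 11 12 preserved₁₁ preserved₁₂ (end₁ e) (end₂ e) e (UpTo₁ (suc (toℕ e)))
                e₁≡ e₂≡ joins (offD off₁ off₂) sc))))
        where
        joins : Joins e (end₁ e) (end₂ e)
        joins = inj₁ (refl , refl)

        offD : ¬ (Opt.through (end₁ e) e (end₂ e) ≤ᶜ dₛ t) → ¬ (Opt.through (end₂ e) e (end₁ e) ≤ᶜ dₛ t) →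
            Opt.OffD e
        offD off₁ off₂ (inj₁ (refl , refl)) = off₁
        offD off₁ off₂ (inj₂ (refl , refl)) = off₂

        Done : Triples
        Done = (UpTo₁ (suc (toℕ e)) ∪₁ (end₁ e , e , end₂ e)) ∪₁ (end₂ e , e , end₁ e)

        covered : ∀ u f v → Opt.Candidate u f v → toℕ e ≤ toℕ f → Done u f v
        covered u f v c e≤f with toℕ e ℕ.≟ toℕ f
        ... | no e≢f = inj₁ (inj₁ (ℕ.≤∧≢⇒< e≤f e≢f))
        ... | yes e≡f with Fin.toℕ-injective e≡f | Opt.Candidate.joins c
        ...   | refl | inj₁ (refl , refl) = inj₁ (inj₂ refl)
        ...   | refl | inj₂ (refl , refl) = inj₂ refl

        finish : ∀ {σ} → Scanned e Done σ → words σ 10 0 ≡ toℕ e × J (toℕ e) σ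
        finish (scanned i≡ _ _ inp trees labelled best) =
          i≡ , inp , trees , labelled , Best-weaken Done (UpTo₁ (toℕ e)) covered best

      body : ∀ e {σ} → words σ 10 0 ≡ toℕ e → J (suc (toℕ e)) σ →
        Runs L (loadEdge ⨟ scanEdge) σ 18 (λ σ′ → words σ′ 10 0 ≡ toℕ e × J (toℕ e) σ′)
      body e {σ} i≡ (inp , trees , labelled , best) = runs-seq L (loadEdge-runs e i≡ inp
        (scan e (scanned i≡ refl refl inp trees labelled best)))

    -- Writing the path from the two branches

    data Chain (f : ℕ → ℕ) (a : Side) (x : ℕ) : List (Fin n) → Set where
      nil  : x ≡ 0 → Chain f a x []
      cons : ∀ {v vs} → x ≡ cell a v → Chain f a (f (cell a v)) vs → Chain f a x (v ∷ vs)

    path : ∀ a → Fin n → List (Fin n)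
    path a v = walkVertices G (Tr.branchWalk a (Tr.branch a v))

    path-chain : ∀ {f} → HasTrees f tree → ∀ a v → Chain f a (cell a v) (path a v)
    path-chain {f} trees a v = go (Tr.branch a v)
      where
      go : ∀ {v} (b : Tr.Branch a v) → Chain f a (cell a v) (walkVertices G (Tr.branchWalk a b))
      go Tree.root           = cons refl (nil (HasTrees.at-root trees a))
      go (Tree.up {v} v≢r b) =
          cons refl (subst (λ x → Chain f a x _) (sym (HasTrees.at-parent trees a v v≢r)) (go b))

    path-length : ∀ a v → List.length (path a v) ≤ n
    path-length a v = Unique⇒length≤
      (geodesic⇒Unique G (potential a) (Tr.branchWalk a (Tr.branch a v))
          (Tr.branchWalk-geodesic a (Tr.branch a v)))

    1≤?-cell : ∀ a v {x} → x ≡ cell a v → does (1 ℕ.≤? x) ≡ true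
    1≤?-cell a v refl = dec-true (1 ℕ.≤? cell a v) (1≤cell a v)

    1≤?-nil : ∀ {x} → x ≡ 0 → does (1 ℕ.≤? x) ≡ false
    1≤?-nil refl = refl

    module _ (u v : Fin n) where

      pathₛ pathₜ total : List (Fin n)
      pathₛ = path S u
      pathₜ = path T v
      total = reverse pathₛ ++ pathₜ

      lengthₛ : ℕ
      lengthₛ = List.length pathₛ

      length-total≤L : List.length total ≤ L
      length-total≤L = ℕ.≤-trans (ℕ.≤-reflexive (trans (List.length-++ (reverse pathₛ))
          (cong (_+ List.length pathₜ) (List.length-reverse pathₛ))))
        (ℕ.≤-trans (ℕ.+-mono-≤ (path-length S u) (path-length T v)) n+n≤L)

      lengthₛ≤L : lengthₛ ≤ L
      lengthₛ≤L = ℕ.≤-trans (path-length S u) (ℕ.≤-trans (ℕ.m≤m+n n n) n+n≤L)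

      record Walking (a : Side) (rest : List (Fin n)) (σ : State R) : Set ℓ₀ where
        constructor walking
        field
          inp   : Input σ
          trees : HasTrees (words σ 5) tree
          b₁≡   : words σ 13 0 ≡ cell S u
          b₂≡   : words σ 14 0 ≡ cell T v
          chain : Chain (words σ 5) a (words σ 15 0) rest

      record Counting (k : ℕ) (σ : State R) : Set ℓ₀ where
        constructor counting
        field
          rest    : List (Fin n)
          rest≡   : List.length rest ≡ k
          walk    : Walking S rest σ
          counted : words σ 16 0 + k ≡ lengthₛ

      countVertices-runs : ∀ {σ} → Walking S pathₛ (setWord 15 (cell S u) σ) →
        Runs L countVertices σ (1 + (1 + (1 + lengthₛ * 3))) (Counting 0)
      countVertices-runs {σ} wk@(walking inp trees b₁≡ b₂≡ _) =
        runs-seq L (runs-word L refl b₁≡ z≤n z≤n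
          (runs-seq L (runs-word L refl refl z≤n z≤n
            (runs-while L Counting 2 exit loop
              (counting pathₛ refl (walking inp trees b₁≡ b₂≡ (Walking.chain wk)) refl)))))
        where
        exit : ∀ {σ} → Counting 0 σ →
            Fitsᵗ L σ (lit 1 ≤ʷ 15 [ lit 0 ]) × evalᵗ σ (lit 1 ≤ʷ 15 [ lit 0 ]) ≡ false × Counting 0 σ
        exit inv@(counting [] _ (walking _ _ _ _ (nil x≡0)) _) = (1≤L , z≤n) , 1≤?-nil x≡0 , inv

        loop : ∀ {k σ} → Counting (suc k) σ →
          Fitsᵗ L σ (lit 1 ≤ʷ 15 [ lit 0 ]) × evalᵗ σ (lit 1 ≤ʷ 15 [ lit 0 ]) ≡ true ×
          Runs L (16 [ lit 0 ]≔ 16 [ lit 0 ] ⊕ lit 1 ⨟ 15 [ lit 0 ]≔ 5 [ 15 [ lit 0 ] ]) σ 2 (Counting k)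
        loop {k} {σ} (counting (x ∷ rest) refl (walking inp trees b₁≡ b₂≡ (cons x≡ chain)) counted) =
          (1≤L , z≤n) , 1≤?-cell S x x≡ ,
          runs-seq L (runs-word L refl refl z≤n (z≤n , 1≤L , fits)
            (runs-word L refl (cong (words σ 5) x≡) z≤n z≤n
              (counting rest refl (walking inp trees b₁≡ b₂≡ chain)
                (trans (cong (_+ k) (ℕ.+-comm (words σ 16 0) 1))
                    (trans (sym (ℕ.+-suc (words σ 16 0) k)) counted)))))
          where
          fits : words σ 16 0 + 1 ≤ L
          fits = ℕ.≤-trans (ℕ.+-monoʳ-≤ (words σ 16 0) (s≤s z≤n))
              (ℕ.≤-trans (ℕ.≤-reflexive counted) lengthₛ≤L)

      -- A round moves one vertex from `rest` to the front of `written`, and `split` then persists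
      -- by the very definition of `_ʳ++_`. The position is the number of vertices still to come, so
      -- the last one, `s`, lands in cell 0.
      record Backwards (k : ℕ) (σ : State R) : Set ℓ₀ where
        constructor backwards
        field
          rest    : List (Fin n)
          rest≡   : List.length rest ≡ k
          walk    : Walking S rest σ
          pos≡    : words σ 16 0 ≡ k
          count≡  : words σ 17 0 ≡ lengthₛ
          written : List (Fin n)
          holds   : Holds (words σ 4) k written
          split   : rest ʳ++ written ≡ reverse pathₛ

      writeBackwards-runs : ∀ {σ} → Walking S pathₛ (setWord 15 (cell S u) σ) → words σ 16 0 ≡ lengthₛ →
        Runs L writeBackwards σ (1 + (1 + (1 + lengthₛ * 4))) (Backwards 0)
      writeBackwards-runs {σ} wk@(walking inp trees b₁≡ b₂≡ _) pos≡ =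
        runs-seq L (runs-word L refl b₁≡ z≤n z≤n
          (runs-seq L (runs-word L refl pos≡ z≤n z≤n
            (runs-while L Backwards 3 exit loop
              (backwards pathₛ refl (walking inp trees b₁≡ b₂≡ (Walking.chain wk)) pos≡ refl [] _ refl)))))
        where
        exit : ∀ {σ} → Backwards 0 σ →
            Fitsᵗ L σ (lit 1 ≤ʷ 15 [ lit 0 ]) × evalᵗ σ (lit 1 ≤ʷ 15 [ lit 0 ]) ≡ false × Backwards 0 σ
        exit inv@(backwards [] _ (walking _ _ _ _ (nil x≡0)) _ _ _ _ _) = (1≤L , z≤n) , 1≤?-nil x≡0 , inv

        loop : ∀ {k σ} → Backwards (suc k) σ →
          Fitsᵗ L σ (lit 1 ≤ʷ 15 [ lit 0 ]) × evalᵗ σ (lit 1 ≤ʷ 15 [ lit 0 ]) ≡ true ×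
          Runs L (16 [ lit 0 ]≔ 16 [ lit 0 ] ⊖ lit 1 ⨟ 4 [ 16 [ lit 0 ] ]≔ 15 [ lit 0 ] ⊖ lit 1 ⨟
                  15 [ lit 0 ]≔ 5 [ 15 [ lit 0 ] ]) σ 3 (Backwards k)
        loop {k} {σ} (backwards (x ∷ rest) refl
            (walking inp trees b₁≡ b₂≡ (cons x≡ chain)) pos≡ count≡ written holds split) =
          (1≤L , z≤n) , 1≤?-cell S x x≡ ,
          runs-seq L (runs-word L {i′ = 0} refl (cong (ℕ._∸ 1) pos≡) z≤n (z≤n , 1≤L)
            (runs-seq L (runs-word L {i′ = k} refl (cong (ℕ._∸ 1) x≡) z≤n (z≤n , 1≤L)
              (runs-word L {i′ = 0} refl (cong (words σ 5) x≡) z≤n z≤n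
                (backwards rest refl (walking inp trees b₁≡ b₂≡ chain) refl count≡ (x ∷ written)
                  (write-elim (_≡ toℕ x) 4 k (toℕ x) (words σ) k (λ _ → refl)
                      (λ ne → contradiction refl ne) ,
                   Holds-cong (suc k) written
                       (λ {j} k<j _ → write-elim (_≡ words σ 4 j) 4 k (toℕ x) (words σ) j
                     (λ eq → contradiction eq (ℕ.<⇒≢ k<j)) (λ _ → refl)) holds)
                  split)))))

      record Forwards (k : ℕ) (σ : State R) : Set ℓ₀ where
        constructor forwards
        field
          rest    : List (Fin n)
          rest≡   : List.length rest ≡ k
          walk    : Walking T rest σ
          written : List (Fin n)
          pos≡    : words σ 16 0 ≡ List.length written
          holds   : Holds (words σ 4) 0 written
          split   : written ++ rest ≡ total

      writeForwards-runs : ∀ {σ} → Walking T pathₜ (setWord 15 (cell T v) σ) → words σ 17 0 ≡ lengthₛ →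
        Holds (words σ 4) 0 (reverse pathₛ) →
        Runs L writeForwards σ (1 + (1 + (1 + List.length pathₜ * 4))) (Forwards 0)
      writeForwards-runs {σ} wk@(walking inp trees b₁≡ b₂≡ _) count≡ holds =
        runs-seq L (runs-word L refl b₂≡ z≤n z≤n
          (runs-seq L (runs-word L refl count≡ z≤n z≤n
            (runs-while L Forwards 3 exit loop
              (forwards pathₜ refl (walking inp trees b₁≡ b₂≡ (Walking.chain wk)) (reverse pathₛ)
                (sym (List.length-reverse pathₛ)) holds refl)))))
        where
        exit : ∀ {σ} → Forwards 0 σ →
            Fitsᵗ L σ (lit 1 ≤ʷ 15 [ lit 0 ]) × evalᵗ σ (lit 1 ≤ʷ 15 [ lit 0 ]) ≡ false × Forwards 0 σ
        exit inv@(forwards [] _ (walking _ _ _ _ (nil x≡0)) _ _ _ _) = (1≤L , z≤n) , 1≤?-nil x≡0 , inv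

        loop : ∀ {k σ} → Forwards (suc k) σ →
          Fitsᵗ L σ (lit 1 ≤ʷ 15 [ lit 0 ]) × evalᵗ σ (lit 1 ≤ʷ 15 [ lit 0 ]) ≡ true ×
          Runs L (4 [ 16 [ lit 0 ] ]≔ 15 [ lit 0 ] ⊖
              (lit 1 ⊕ 0 [ lit 0 ]) ⨟ 16 [ lit 0 ]≔ 16 [ lit 0 ] ⊕ lit 1 ⨟
                  15 [ lit 0 ]≔ 5 [ 15 [ lit 0 ] ]) σ 3 (Forwards k)
        loop {k} {σ} (forwards (x ∷ rest) refl
            (walking inp trees b₁≡ b₂≡ (cons x≡ chain)) written pos≡ holds split) =
          (1≤L , z≤n) , 1≤?-cell T x x≡ ,
          runs-seq L (runs-word L {i′ = p} pos≡ value z≤n (z≤n , 1≤L , z≤n , fits-1+n)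
            (runs-seq L (runs-word L {i′ = 0} refl (trans (cong (_+ 1) pos≡) (ℕ.+-comm p 1)) z≤n
                (z≤n , 1≤L , fits)
              (runs-word L {i′ = 0} refl (cong (words σ 5) x≡) z≤n z≤n
                (forwards rest refl (walking inp trees b₁≡ b₂≡ chain) (written List.∷ʳ x)
                  (trans (ℕ.+-comm 1 p) (sym (List.length-++ written)))
                  (Holds-snoc 0 written x
                    (Holds-cong 0 written (λ {j} _ j<p → write-elim (_≡ words σ 4 j) 4 p (toℕ x) (words σ) j
                      (λ eq → contradiction (sym eq) (ℕ.<⇒≢ j<p)) (λ _ → refl)) holds)
                    (write-elim (_≡ toℕ x) 4 p (toℕ x) (words σ) p (λ _ → refl)
                        (λ ne → contradiction refl ne)))
                  (trans (List.++-assoc written (x ∷ []) rest) split))))))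
          where
          p = List.length written

          value : words σ 15 0 ℕ.∸ (1 + words σ 0 0) ≡ toℕ x
          value = trans (cong₂ ℕ._∸_ x≡ (cong suc (IsInput.n≡ inp))) (ℕ.m+n∸m≡n n (toℕ x))

          fits-1+n : 1 + words σ 0 0 ≤ L
          fits-1+n = ℕ.≤-trans (s≤s (ℕ.≤-trans (ℕ.≤-reflexive (IsInput.n≡ inp)) (ℕ.m≤m+n n (toℕ x))))
              (cell≤L T x)

          fits : words σ 16 0 + 1 ≤ L
          fits = ℕ.≤-trans (ℕ.≤-reflexive (cong (_+ 1) pos≡))
            (ℕ.≤-trans (ℕ.+-monoʳ-≤ p (s≤s z≤n))
              (ℕ.≤-trans (ℕ.≤-reflexive
                  (trans (sym (List.length-++ written)) (cong List.length split))) length-total≤L))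

    output-runs : ∀ {σ} → Input σ → HasTrees (words σ 5) tree →
      Best (UpTo₁ 0) (words σ 13 0) (words σ 14 0) (nums σ 3 0) →
      Runs L outputPath σ (1 + (1 + ((3 + n * 3) + ((3 + n * 4) + ((3 + n * 4) + 1)))))
          (SolvesOptimalOutwardPath G s t)
    output-runs {σ} inp trees best =
      runs-seq L (runs-word L {i′ = 0} {j′ = 0} refl refl z≤n z≤n (report best))
      where
      Solved : State R → Set _
      Solved = SolvesOptimalOutwardPath G s t

      σ₀ : State R
      σ₀ = setWord 3 0 σ

      report : Best (UpTo₁ 0) (words σ 13 0) (words σ 14 0) (nums σ 3 0) →
        Runs L (cond (13 [ lit 0 ] ≤ʷ lit 0) skip
          (countVertices ⨟ writeBackwards ⨟ writeForwards ⨟ 3 [ lit 0 ]≔ 16 [ lit 0 ])) σ₀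
          (1 + ((3 + n * 3) + ((3 + n * 4) + ((3 + n * 4) + 1)))) Solved
      report (inj₁ (b₁≡0 , none)) = runs-cond-word L {Q = Solved} b₁≡0 (refl {x = 0}) z≤n z≤n
        (λ _ → runs-weaken L (s≤s z≤n) (runs-skip L (inj₂ (no-outward-path , refl))))
        (λ ≰0 → contradiction z≤n ≰0)
        where
        no-outward-path : ¬ (Σ[ p ∈ Path G s t ] Outward G p)
        no-outward-path (p , outward) =
          let u , e , v , c , _ = Opt.outward⇒candidate p outward in none u e v z≤n c
      report (inj₂ (u , e , v , c , b₁≡ , b₂≡ , _ , least)) =
        runs-cond-word L {Q = Solved} b₁≡ (refl {x = 0}) z≤n z≤n
          (λ ())
          (λ _ → runs-seq L (runs-weaken L (ℕ.+-monoʳ-≤ 3 (ℕ.*-monoˡ-≤ 3 (path-length S u)))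
            (runs-map L (λ {σ₁} → backward {σ₁})
              (countVertices-runs u v {σ₀} (walking inp trees b₁≡ b₂≡ (path-chain trees S u))))))
        where
        solution = Opt.minimal⇒optimal c (λ {u′} {e′} {v′} → least u′ e′ v′ z≤n)
        p = proj₁ solution

        total≡ : total u v ≡ vertices G p
        total≡ = sym (trans (proj₂ (proj₂ solution)) (List.ʳ++-defn (path S u)))

        finish : ∀ {σ} → Forwards u v 0 σ → Runs L (3 [ lit 0 ]≔ 16 [ lit 0 ]) σ 1 Solved
        finish {σ} (forwards [] _ _ written pos≡ holds split) =
          runs-word L {i′ = 0} refl pos≡ z≤n z≤n (inj₁ (p , proj₁ (proj₂ solution) ,
            cong List.length written≡ ,
                subst (λ vs → ∀ i → words σ 4 (toℕ i) ≡ toℕ (List.lookup vs i)) written≡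
                    (Holds-lookup 0 written holds)))
          where
          written≡ : written ≡ vertices G p
          written≡ = trans (sym (List.++-identityʳ written)) (trans split total≡)

        forward : ∀ {σ} → Backwards u v 0 σ →
          Runs L (writeForwards ⨟ 3 [ lit 0 ]≔ 16 [ lit 0 ]) σ ((3 + n * 4) + 1) Solved
        forward {σ} (backwards [] _ (walking inp trees b₁≡ b₂≡ _) _ count≡ written holds split) =
          runs-seq L (runs-weaken L (ℕ.+-monoʳ-≤ 3 (ℕ.*-monoˡ-≤ 4 (path-length T v)))
            (runs-map L (λ {σ₁} → finish {σ₁})
              (writeForwards-runs u v {σ} (walking inp trees b₁≡ b₂≡ (path-chain trees T v)) count≡
                (subst (Holds (words σ 4) 0) split holds))))

        backward : ∀ {σ} → Counting u v 0 σ →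
          Runs L (writeBackwards ⨟ writeForwards ⨟ 3 [ lit 0 ]≔ 16 [ lit 0 ]) σ
              ((3 + n * 4) + ((3 + n * 4) + 1)) Solved
        backward {σ} (counting [] _ (walking inp trees b₁≡ b₂≡ _) counted) =
          runs-seq L (runs-weaken L (ℕ.+-monoʳ-≤ 3 (ℕ.*-monoˡ-≤ 4 (path-length S u)))
            (runs-map L (λ {σ₁} → forward {σ₁})
              (writeBackwards-runs u v {σ} (walking inp trees b₁≡ b₂≡ (path-chain trees S u))
                (trans (sym (ℕ.+-identityʳ _)) counted))))

  -- Composition of the phases and the linear bounds

  running-time : ℕ
  running-time = (1 + (1 + n * 5)) + ((1 + (1 + m * 12)) + ((1 + (1 + (n + n) * 7 + (n + n) * 5)) +
    ((1 + (1 + (1 + m * 20))) + (1 + (1 + ((3 + n * 3) + ((3 + n * 4) + ((3 + n * 4) + 1))))))))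

  optimalOutwardPath-runs : dₜ s ≤ᶜ dₛ t → dₛ t ≤ᶜ dₜ s → ∀ {σ} → Input σ →
    (∀ i → words σ 5 i ≡ 0) → (∀ i → words σ 6 i ≡ 0) →
    Runs L optimalOutwardPath σ running-time (SolvesOptimalOutwardPath G s t)
  optimalOutwardPath-runs dₜ[s]≤dₛ[t] dₛ[t]≤dₜ[s] inp zero₅ zero₆ =
    runs-seq L (runs-map L (λ (inp , zero₅ , initial) →
      runs-seq L (runs-map L (λ (inp , initial , parents) → solve-with inp initial (parents⇒trees parents))
        (findParents-runs inp zero₅ initial)))
      (initLabels-runs inp zero₅ zero₆))
    where
    solve-with : ∀ {σ} → Input σ → InitialLabels (words σ 6) → ∃[ tree ] HasTrees (words σ 5) tree →
      Runs L (propagateLabels ⨟ findCandidate ⨟ outputPath) σ _ (SolvesOptimalOutwardPath G s t)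
    solve-with inp initial (tree , trees) =
      runs-seq L (runs-map L (λ (inp , trees , labelled) →
        runs-seq L (runs-map L (λ (inp , trees , best) → output-runs inp trees best)
          (findCandidate-runs inp trees labelled)))
        (propagateLabels-runs inp initial trees))
      where
      open Phases tree dₜ[s]≤dₛ[t] dₛ[t]≤dₜ[s]

pad-toℕ : ∀ {a} {A : Set a} {k} d (f : Fin k → A) i → pad d f (toℕ i) ≡ f i
pad-toℕ d f Fin.zero    = refl
pad-toℕ d f (Fin.suc i) = pad-toℕ d (f ∘ Fin.suc) i

module _ {a ℓ₁ ℓ₂} {R : OrderedAbelianGroup a ℓ₁ ℓ₂} {n m : ℕ} (G : Graph R n m)
  (s t : Fin n) (dₛ dₜ : Fin n → OrderedAbelianGroup.Carrier R)
  (distₛ : ∀ v → IsDistance G s v (dₛ v)) (distₜ : ∀ v → IsDistance G v t (dₜ v)) where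
  open OrderedAbelianGroup R using (_≈_; isDecTotalOrder; isAbelianGroup) renaming (_≤_ to _≤ᶜ_)
  private
    module O = IsDecTotalOrder isDecTotalOrder
    module ≈ = IsAbelianGroup isAbelianGroup

    distance-≤ : ∀ {u v d d′} → IsDistance G u v d → IsDistance G u v d′ → d ≤ᶜ d′
    distance-≤ (p , shortest , len) (q , _ , len′) =
      O.trans (O.reflexive (≈.sym len)) (O.trans (shortest q) (O.reflexive len′))

    1≤n : 1 ≤ n
    1≤n = ℕ.≤-trans (s≤s z≤n) (Fin.toℕ<n s)

    n≤m+n : n ≤ m + n
    n≤m+n = ℕ.m≤n+m n m

    -- The literal 3, the address of `t` among the input words, must fit even when the graph is a
    -- single vertex. The factor 4 leaves room for it as well as for the `n + n` tree cells.
    3≤L : 3 ≤ 4 * (m + n)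
    3≤L = ℕ.≤-trans (ℕ.n≤1+n 3) (ℕ.*-monoʳ-≤ 4 (ℕ.≤-trans 1≤n n≤m+n))

    m≤L : m ≤ 4 * (m + n)
    m≤L = ℕ.≤-trans (ℕ.m≤m+n m n) (ℕ.m≤m+n (m + n) _)

    n+n≤L : n + n ≤ 4 * (m + n)
    n+n≤L = ℕ.+-mono-≤ n≤m+n (ℕ.≤-trans n≤m+n (ℕ.m≤m+n (m + n) _))

    module C = Correctness G s t dₛ dₜ
      (distance⇒potential G (λ v → IsDistance-sym G (distₛ v))) (distance⇒potential G distₜ)
      (4 * (m + n)) 3≤L m≤L n+n≤L

    isInput : C.Input (input G s t dₛ dₜ)
    isInput = record
      { n≡ = refl ; m≡ = refl ; t≡ = refl
      ; end₁≡ = pad-toℕ _ _ ; end₂≡ = pad-toℕ _ _ ; w≡ = pad-toℕ _ _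
      ; dₛ≡ = pad-toℕ _ _ ; dₜ≡ = pad-toℕ _ _ }

    linear-time : C.running-time ≤ 61 * (m + n)
    linear-time = ℕ.≤-trans (ℕ.≤-reflexive (collect m n))
      -- The additive 21 is absorbed into `n`, which is positive because `s` is a vertex. This makes
      -- the coefficient of `n` equal to 21 + 40 = 61, and adding 29 raises that of `m` from 32 to
      -- the same value.
      (ℕ.≤-trans (ℕ.+-monoˡ-≤ _ (ℕ.*-monoʳ-≤ 21 1≤n))
        (ℕ.≤-trans (ℕ.m≤m+n _ (29 * m)) (ℕ.≤-reflexive (distribute m n))))
      where
      collect : ∀ m n → (1 + (1 + n * 5)) + ((1 + (1 + m * 12)) + ((1 + (1 + (n + n) * 7 + (n + n) * 5)) +
        ((1 + (1 + (1 + m * 20))) + (1 + (1 + ((3 + n * 3) + ((3 + n * 4) + ((3 + n * 4) + 1))))))))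
        ≡ 21 * 1 + (40 * n + 32 * m)
      collect = solve-∀

      distribute : ∀ m n → 21 * n + (40 * n + 32 * m) + 29 * m ≡ 61 * (m + n)
      distribute = solve-∀

  optimalOutwardPath-solves : ∃[ σ ] ∃[ τ ]
    4 * (m + n) ⊢⟨ optimalOutwardPath , input G s t dₛ dₜ ⟩⇓⟨ σ , τ ⟩ × τ ≤ 61 * (m + n) ×
        SolvesOptimalOutwardPath G s t σ
  optimalOutwardPath-solves =
      _ , _ , Runs.run result , ℕ.≤-trans (Runs.bound result) linear-time , Runs.post result
    where
    result : Runs (4 * (m + n)) optimalOutwardPath (input G s t dₛ dₜ) C.running-time
        (SolvesOptimalOutwardPath G s t)
    result = C.optimalOutwardPath-runs (distance-≤ (distₜ s) (distₛ t)) (distance-≤ (distₛ t) (distₜ s))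
      isInput (λ _ → refl) (λ _ → refl)

theorem2 : ∀ {a ℓ₁ ℓ₂} →
    Σ[ P ∈ Program ] Σ[ κ ∈ ℕ ] Σ[ c ∈ ℕ ]
    ((R : OrderedAbelianGroup a ℓ₁ ℓ₂) →
    let open OrderedAbelianGroup R using (Carrier) in
    ∀ {n m} (G : Graph R n m) → Connected G →
    (s t : Fin n) (dₛ dₜ : Fin n → Carrier) →
    (∀ v → IsDistance G s v (dₛ v)) →
    (∀ v → IsDistance G v t (dₜ v)) →
    ∃[ σ ] ∃[ τ ]
    κ * (m + n) ⊢⟨ P , input G s t dₛ dₜ ⟩⇓⟨ σ , τ ⟩ ×
    τ ≤ c * (m + n) ×
    SolvesOptimalOutwardPath G s t σ)
theorem2 = optimalOutwardPath , 4 , 61 ,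
  λ R G _ s t dₛ dₜ distₛ distₜ → optimalOutwardPath-solves G s t dₛ dₜ distₛ distₜ
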